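{- For each of the two problems "discrete $k$-median in the $\ell_1$-metric" and "discrete $k$-means in the $\ell_2$-metric", and for every $\varepsilon>0$, there exist $\delta>0$ and a family of well-separated instances (for infinitely many values of $k$) such that for every instance in the family, the minimum cost of an integral solution that is allowed to open up to $k+\delta k$ centers is at least $\left(\frac{149}{125}-\varepsilon\right)$ times the optimal value of the basic SDP relaxation of the instance with parameter $k$. That is, the SDP relaxation has a gap of at least $149/125-\varepsilon\approx1.192-\varepsilon$, even when the integral solution opens $\Omega(k)$ more centers.
   Context: An instance consists of a finite set $\mathcal{C}\subset\mathbb{R}^N$ of candidate centers, a finite set $\mathcal{P}\subset\mathbb{R}^N$ of points, and $k\in\mathbb{N}$. For $p\in\mathcal{P}$, $c\in\mathcal{C}$, let $d_{p,c}=\|p-c\|_1$ for $k$-median in $\ell_1$, and $d_{p,c}=\|p-c\|_2^2$ for $k$-means in $\ell_2$. An integral solution opening a set $C\subseteq\mathcal{C}$ has cost $\sum_{p\in\mathcal{P}}\min_{c\in C}d_{p,c}$. The basic SDP relaxation has vector variables $v_0$, $v_{p,c}$ ($p\in\mathcal{P},c\in\mathcal{C}$), $u_c$ ($c\in\mathcal{C}$) in a Euclidean space of arbitrary finite dimension: minimize $\sum_{p\in\mathcal{P}}\sum_{c\in\mathcal{C}}\|v_{p,c}\|_2^2\,d_{p,c}$ subject to $\langle v_0,v_0\rangle=1$; $\langle v_{p,c},v_0\rangle=\|v_{p,c}\|_2^2$ for all $p,c$; $\langle u_c,v_0\rangle=\|u_c\|_2^2$ for all $c$; $\langle v_{p,c},u_c\rangle=\|v_{p,c}\|_2^2$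 for all $p,c$; $\|\sum_{c\in\mathcal{C}}v_{p,c}-v_0\|_2^2=0$ for all $p$; and $\sum_{c\in\mathcal{C}}\|u_c\|_2^2\le k$. An instance is well-separated if, after normalizing so that the average connection cost of a point in the SDP solution is $1$, every pair of distinct points in $\mathcal{P}\cup\mathcal{C}$ is at distance at least $1$. -}

module Defs where

open import Data.Nat as ℕ using (ℕ)
import Data.Nat.Properties as ℕₚ
open import Data.Integer using (+_)
open import Data.Rational as ℚ using (ℚ; 0ℚ; 1ℚ; ½)
import Data.Rational.Properties as ℚₚ
open import Data.Rational.Solver using (module +-*-Solver)
open import Data.Fin using (Fin)
open import Data.Fin.Subset using (Subset; ∣_∣; Nonempty)
open import Data.Fin.Subset.Properties using (_∈?_)
open import Data.List as List using (List; filter; allFin)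
open import Data.Vec.Functional as Vector using (Vector)
open import Data.Product using (Σ; ∃; _×_; _,_; proj₁; proj₂)
open import Data.Sum using (_⊎_; inj₁; inj₂; [_,_]′)
open import Function.Definitions using (Injective)
open import Relation.Binary.PropositionalEquality
  using (_≡_; refl; sym; trans; cong; cong₂; subst)
open import Relation.Nullary using (¬_)

------------------------------------------------------------------------
-- Real numbers

-- Cauchy sequences of rationals, compared up to the setoid equality _≈_.
-- The existentials are Σ-types, so every sequence carries a modulus of
-- convergence.

infix 4 _⟶[_]_
_⟶[_]_ : ℚ → ℚ → ℚ → Set
p ⟶[ ε ] q = ℚ.∣ p ℚ.- q ∣ ℚ.≤ ε

Eventually : (ℕ → Set) → Set
Eventually P = ∃ λ N → ∀ n → N ℕ.≤ n → P n

IsCauchy : (ℕ → ℚ) → Set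
IsCauchy x = ∀ ε → 0ℚ ℚ.< ε →
  ∃ λ N → ∀ m n → N ℕ.≤ m → N ℕ.≤ n → x m ⟶[ ε ] x n

record ℝ : Set where
  constructor mkℝ
  field
    seq    : ℕ → ℚ
    cauchy : IsCauchy seq

open ℝ public

Nonexpansive₂ : (ℚ → ℚ → ℚ) → Set
Nonexpansive₂ f = ∀ a b c d →
  f a b ⟶[ ℚ.∣ a ℚ.- c ∣ ℚ.+ ℚ.∣ b ℚ.- d ∣ ] f c d

-- Abstract, so that the convergence proofs inside real-number terms are
-- never unfolded.
module Lemmas where
  abstract
    half-pos : ∀ {ε} → 0ℚ ℚ.< ε → 0ℚ ℚ.< ½ ℚ.* ε
    half-pos {ε} 0<ε =
      subst (ℚ._< ½ ℚ.* ε) (ℚₚ.*-zeroʳ ½) (ℚₚ.*-monoʳ-<-pos ½ 0<ε)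

    halves : ∀ ε → ½ ℚ.* ε ℚ.+ ½ ℚ.* ε ≡ ε
    halves ε = trans (sym (ℚₚ.*-distribʳ-+ ε ½ ½)) (ℚₚ.*-identityˡ ε)

    abs-≤ : ∀ {p q} → p ℚ.≤ q → ℚ.- p ℚ.≤ q → ℚ.∣ p ∣ ℚ.≤ q
    abs-≤ {p} {q} h k with ℚₚ.∣p∣≡p∨∣p∣≡-p p
    ... | inj₁ e = subst (ℚ._≤ q) (sym e) h
    ... | inj₂ e = subst (ℚ._≤ q) (sym e) k

    ≤-abs : ∀ p → p ℚ.≤ ℚ.∣ p ∣
    ≤-abs p with ℚₚ.≤-total 0ℚ p
    ... | inj₁ 0≤p = ℚₚ.≤-reflexive (sym (ℚₚ.0≤p⇒∣p∣≡p 0≤p))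
    ... | inj₂ p≤0 = ℚₚ.≤-trans p≤0 (ℚₚ.0≤∣p∣ p)

    dist-sym : ∀ p q → ℚ.∣ p ℚ.- q ∣ ≡ ℚ.∣ q ℚ.- p ∣
    dist-sym p q = trans (sym (ℚₚ.∣-p∣≡∣p∣ (p ℚ.- q)))
      (cong ℚ.∣_∣ (solve 2 (λ a b → :- (a :- b) := b :- a) refl p q))
      where open +-*-Solver

    diff-≤ : ∀ {p q e} → p ℚ.≤ q ℚ.+ e → p ℚ.- q ℚ.≤ e
    diff-≤ {p} {q} {e} h = ℚₚ.≤-trans (ℚₚ.+-monoˡ-≤ (ℚ.- q) h)
      (ℚₚ.≤-reflexive (solve 2 (λ a b → a :+ b :- a := b) refl q e))
      where open +-*-Solver

    dist-≤ : ∀ {p q e} → p ℚ.≤ q ℚ.+ e → q ℚ.≤ p ℚ.+ e → p ⟶[ e ] q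
    dist-≤ {p} {q} {e} h k = abs-≤ (diff-≤ h)
      (subst (ℚ._≤ e) (solve 2 (λ a b → b :- a := :- (a :- b)) refl p q)
        (diff-≤ k))
      where open +-*-Solver

    lift₂-cauchy : ∀ f → Nonexpansive₂ f → ∀ x y →
      IsCauchy (λ n → f (seq x n) (seq y n))
    lift₂-cauchy f ne x y ε 0<ε = combine
      (cauchy x (½ ℚ.* ε) (half-pos 0<ε)) (cauchy y (½ ℚ.* ε) (half-pos 0<ε))
      where
      combine :
        (∃ λ N → ∀ m n → N ℕ.≤ m → N ℕ.≤ n → seq x m ⟶[ ½ ℚ.* ε ] seq x n) →
        (∃ λ N → ∀ m n → N ℕ.≤ m → N ℕ.≤ n → seq y m ⟶[ ½ ℚ.* ε ] seq y n) →
        ∃ λ N → ∀ m n → N ℕ.≤ m → N ℕ.≤ n →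
          f (seq x m) (seq y m) ⟶[ ε ] f (seq x n) (seq y n)
      combine (M , p) (N , q) = M ℕ.⊔ N , λ m n h k → ℚₚ.≤-trans
        (ne (seq x m) (seq y m) (seq x n) (seq y n))
        (ℚₚ.≤-trans
          (ℚₚ.+-mono-≤
            (p m n (ℕₚ.m⊔n≤o⇒m≤o M N h) (ℕₚ.m⊔n≤o⇒m≤o M N k))
            (q m n (ℕₚ.m⊔n≤o⇒n≤o M N h) (ℕₚ.m⊔n≤o⇒n≤o M N k)))
          (ℚₚ.≤-reflexive (halves ε)))

    +-nonexpansive : Nonexpansive₂ ℚ._+_
    +-nonexpansive a b c d = subst (ℚ._≤ ℚ.∣ a ℚ.- c ∣ ℚ.+ ℚ.∣ b ℚ.- d ∣)
      (cong ℚ.∣_∣ (solve 4 (λ a b c d →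
        (a :- c) :+ (b :- d) := (a :+ b) :- (c :+ d)) refl a b c d))
      (ℚₚ.∣p+q∣≤∣p∣+∣q∣ (a ℚ.- c) (b ℚ.- d))
      where open +-*-Solver

    shift : ∀ p q {e} → ℚ.∣ p ℚ.- q ∣ ℚ.≤ e → p ℚ.≤ q ℚ.+ e
    shift p q {e} h = ℚₚ.≤-trans
      (ℚₚ.≤-reflexive (solve 2 (λ a b → a := b :+ (a :- b)) refl p q))
      (ℚₚ.+-monoʳ-≤ q (ℚₚ.≤-trans (≤-abs (p ℚ.- q)) h))
      where open +-*-Solver

    ⊓-shift : ∀ a b c d {e} → a ℚ.≤ c ℚ.+ e → b ℚ.≤ d ℚ.+ e →
              a ℚ.⊓ b ℚ.≤ c ℚ.⊓ d ℚ.+ e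
    ⊓-shift a b c d {e} h k with ℚₚ.⊓-sel c d
    ... | inj₁ c⊓d≡c = subst (λ z → a ℚ.⊓ b ℚ.≤ z ℚ.+ e) (sym c⊓d≡c)
                         (ℚₚ.≤-trans (ℚₚ.p⊓q≤p a b) h)
    ... | inj₂ c⊓d≡d = subst (λ z → a ℚ.⊓ b ℚ.≤ z ℚ.+ e) (sym c⊓d≡d)
                         (ℚₚ.≤-trans (ℚₚ.p⊓q≤q a b) k)

    ≤-+ʳ : ∀ p q → 0ℚ ℚ.≤ q → p ℚ.≤ p ℚ.+ q
    ≤-+ʳ p q h = subst (ℚ._≤ p ℚ.+ q) (ℚₚ.+-identityʳ p) (ℚₚ.+-monoʳ-≤ p h)

    ≤-+ˡ : ∀ p q → 0ℚ ℚ.≤ p → q ℚ.≤ p ℚ.+ q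
    ≤-+ˡ p q h = subst (ℚ._≤ p ℚ.+ q) (ℚₚ.+-identityˡ q) (ℚₚ.+-monoˡ-≤ q h)

    ⊓-nonexpansive : Nonexpansive₂ ℚ._⊓_
    ⊓-nonexpansive a b c d = dist-≤
      (⊓-shift a b c d (shift a c ac≤) (shift b d bd≤))
      (⊓-shift c d a b (shift c a (≤-swap a c ac≤)) (shift d b (≤-swap b d bd≤)))
      where
      ac≤ : ℚ.∣ a ℚ.- c ∣ ℚ.≤ ℚ.∣ a ℚ.- c ∣ ℚ.+ ℚ.∣ b ℚ.- d ∣
      ac≤ = ≤-+ʳ ℚ.∣ a ℚ.- c ∣ ℚ.∣ b ℚ.- d ∣ (ℚₚ.0≤∣p∣ (b ℚ.- d))
      bd≤ : ℚ.∣ b ℚ.- d ∣ ℚ.≤ ℚ.∣ a ℚ.- c ∣ ℚ.+ ℚ.∣ b ℚ.- d ∣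
      bd≤ = ≤-+ˡ ℚ.∣ a ℚ.- c ∣ ℚ.∣ b ℚ.- d ∣ (ℚₚ.0≤∣p∣ (a ℚ.- c))
      ≤-swap : ∀ p q {r} → ℚ.∣ p ℚ.- q ∣ ℚ.≤ r → ℚ.∣ q ℚ.- p ∣ ℚ.≤ r
      ≤-swap p q {r} = subst (ℚ._≤ r) (dist-sym p q)

    abs-shift : ∀ p q → ℚ.∣ p ∣ ℚ.≤ ℚ.∣ q ∣ ℚ.+ ℚ.∣ p ℚ.- q ∣
    abs-shift p q = ℚₚ.≤-trans
      (ℚₚ.≤-reflexive (cong ℚ.∣_∣
        (solve 2 (λ a b → a := b :+ (a :- b)) refl p q)))
      (ℚₚ.∣p+q∣≤∣p∣+∣q∣ q (p ℚ.- q))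
      where open +-*-Solver

    abs-nonexpansive : ∀ p q → ℚ.∣ p ∣ ⟶[ ℚ.∣ p ℚ.- q ∣ ] ℚ.∣ q ∣
    abs-nonexpansive p q = dist-≤ (abs-shift p q)
      (subst (λ z → ℚ.∣ q ∣ ℚ.≤ ℚ.∣ p ∣ ℚ.+ z) (dist-sym q p) (abs-shift q p))

    neg-nonexpansive : ∀ p q → ℚ.- p ⟶[ ℚ.∣ p ℚ.- q ∣ ] ℚ.- q
    neg-nonexpansive p q = ℚₚ.≤-reflexive (trans
      (cong ℚ.∣_∣ (solve 2 (λ a b → :- a :- (:- b) := b :- a) refl p q))
      (dist-sym q p))
      where open +-*-Solver

    bounded : ∀ x → ∃ λ B → 0ℚ ℚ.< B × Eventually (λ n → ℚ.∣ seq x n ∣ ℚ.≤ B)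
    bounded x with cauchy x 1ℚ (ℚₚ.positive⁻¹ 1ℚ)
    ... | N , p = ℚ.∣ seq x N ∣ ℚ.+ 1ℚ
      , ℚₚ.+-mono-≤-< (ℚₚ.0≤∣p∣ (seq x N)) (ℚₚ.positive⁻¹ 1ℚ)
      , N , λ n h → ℚₚ.≤-trans (abs-shift (seq x n) (seq x N))
          (ℚₚ.+-monoʳ-≤ ℚ.∣ seq x N ∣ (p n N h ℕₚ.≤-refl))

    *-split : ∀ a b c d → ℚ.∣ a ℚ.* b ℚ.- c ℚ.* d ∣ ℚ.≤
              ℚ.∣ a ∣ ℚ.* ℚ.∣ b ℚ.- d ∣ ℚ.+ ℚ.∣ d ∣ ℚ.* ℚ.∣ a ℚ.- c ∣
    *-split a b c d = subst (ℚ.∣ a ℚ.* b ℚ.- c ℚ.* d ∣ ℚ.≤_)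
      (cong₂ ℚ._+_ (ℚₚ.∣p*q∣≡∣p∣*∣q∣ a (b ℚ.- d)) (ℚₚ.∣p*q∣≡∣p∣*∣q∣ d (a ℚ.- c)))
      (subst (λ z → ℚ.∣ z ∣ ℚ.≤ ℚ.∣ a ℚ.* (b ℚ.- d) ∣ ℚ.+ ℚ.∣ d ℚ.* (a ℚ.- c) ∣)
        (solve 4 (λ a b c d →
          a :* (b :- d) :+ d :* (a :- c) := a :* b :- c :* d) refl a b c d)
        (ℚₚ.∣p+q∣≤∣p∣+∣q∣ (a ℚ.* (b ℚ.- d)) (d ℚ.* (a ℚ.- c))))
      where open +-*-Solver

    *-bound : ∀ {p q P Q} → 0ℚ ℚ.≤ q → 0ℚ ℚ.≤ P → p ℚ.≤ P → q ℚ.≤ Q →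
              p ℚ.* q ℚ.≤ P ℚ.* Q
    *-bound {p} {q} {P} {Q} 0≤q 0≤P p≤P q≤Q = ℚₚ.≤-trans
      (ℚₚ.*-monoʳ-≤-nonNeg q {{ℚ.nonNegative 0≤q}} p≤P)
      (ℚₚ.*-monoˡ-≤-nonNeg P {{ℚ.nonNegative 0≤P}} q≤Q)

    divide : ∀ B → 0ℚ ℚ.< B → ∀ ε → 0ℚ ℚ.< ε →
             ∃ λ η → 0ℚ ℚ.< η × B ℚ.* η ≡ ε
    divide B 0<B ε 0<ε = 1/B ℚ.* ε
      , subst (ℚ._< 1/B ℚ.* ε) (ℚₚ.*-zeroʳ 1/B)
          (ℚₚ.*-monoʳ-<-pos 1/B {{ℚₚ.1/pos⇒pos B {{B⁺}}}} 0<ε)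
      , trans (sym (ℚₚ.*-assoc B 1/B ε))
          (trans (cong (ℚ._* ε) (ℚₚ.*-inverseʳ B {{B≢0}})) (ℚₚ.*-identityˡ ε))
      where
      B⁺ : ℚ.Positive B
      B⁺ = ℚ.positive 0<B
      B≢0 : ℚ.NonZero B
      B≢0 = ℚₚ.pos⇒nonZero B {{B⁺}}
      1/B : ℚ
      1/B = (ℚ.1/ B) {{B≢0}}

    *-cauchy : ∀ x y → IsCauchy (λ n → seq x n ℚ.* seq y n)
    *-cauchy x y ε 0<ε = withBounds (bounded x) (bounded y)
      where
      Bounded : ℝ → Set
      Bounded z = ∃ λ B → 0ℚ ℚ.< B × Eventually (λ n → ℚ.∣ seq z n ∣ ℚ.≤ B)

      Goal : Set
      Goal = ∃ λ N → ∀ m n → N ℕ.≤ m → N ℕ.≤ n →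
        seq x m ℚ.* seq y m ⟶[ ε ] seq x n ℚ.* seq y n

      Fraction : ℚ → Set
      Fraction B = ∃ λ η → 0ℚ ℚ.< η × B ℚ.* η ≡ ½ ℚ.* ε

      Modulus : ℝ → ℚ → Set
      Modulus z η = ∃ λ N → ∀ m n → N ℕ.≤ m → N ℕ.≤ n → seq z m ⟶[ η ] seq z n

      withBounds : Bounded x → Bounded y → Goal
      withBounds (A , 0<A , K , f) (B , 0<B , L , g) = withFractions
        (divide A 0<A (½ ℚ.* ε) (half-pos 0<ε))
        (divide B 0<B (½ ℚ.* ε) (half-pos 0<ε))
        where
        withFractions : Fraction A → Fraction B → Goal
        withFractions (α , 0<α , Aα) (β , 0<β , Bβ) =
          withModuli (cauchy y α 0<α) (cauchy x β 0<β)
          where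
          withModuli : Modulus y α → Modulus x β → Goal
          withModuli (M , p) (N , q) = (K ℕ.⊔ L) ℕ.⊔ (M ℕ.⊔ N) , close
            where
            close : ∀ m n → (K ℕ.⊔ L) ℕ.⊔ (M ℕ.⊔ N) ℕ.≤ m →
              (K ℕ.⊔ L) ℕ.⊔ (M ℕ.⊔ N) ℕ.≤ n →
              seq x m ℚ.* seq y m ⟶[ ε ] seq x n ℚ.* seq y n
            close m n h k = ℚₚ.≤-trans
              (*-split (seq x m) (seq y m) (seq x n) (seq y n))
              (ℚₚ.≤-trans
                (ℚₚ.+-mono-≤
                  (*-bound (ℚₚ.0≤∣p∣ (seq y m ℚ.- seq y n)) (ℚₚ.<⇒≤ 0<A)
                    (f m (ℕₚ.m⊔n≤o⇒m≤o K L hKL))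
                    (p m n (ℕₚ.m⊔n≤o⇒m≤o M N hMN) (ℕₚ.m⊔n≤o⇒m≤o M N kMN)))
                  (*-bound (ℚₚ.0≤∣p∣ (seq x m ℚ.- seq x n)) (ℚₚ.<⇒≤ 0<B)
                    (g n (ℕₚ.m⊔n≤o⇒n≤o K L kKL))
                    (q m n (ℕₚ.m⊔n≤o⇒n≤o M N hMN) (ℕₚ.m⊔n≤o⇒n≤o M N kMN))))
                (ℚₚ.≤-reflexive (trans (cong₂ ℚ._+_ Aα Bβ) (halves ε))))
              where
              hKL : K ℕ.⊔ L ℕ.≤ m
              hKL = ℕₚ.m⊔n≤o⇒m≤o (K ℕ.⊔ L) (M ℕ.⊔ N) h
              kKL : K ℕ.⊔ L ℕ.≤ n
              kKL = ℕₚ.m⊔n≤o⇒m≤o (K ℕ.⊔ L) (M ℕ.⊔ N) k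
              hMN : M ℕ.⊔ N ℕ.≤ m
              hMN = ℕₚ.m⊔n≤o⇒n≤o (K ℕ.⊔ L) (M ℕ.⊔ N) h
              kMN : M ℕ.⊔ N ℕ.≤ n
              kMN = ℕₚ.m⊔n≤o⇒n≤o (K ℕ.⊔ L) (M ℕ.⊔ N) k

    neg-cauchy : ∀ x → IsCauchy (λ n → ℚ.- seq x n)
    neg-cauchy x ε 0<ε = proj₁ (cauchy x ε 0<ε) , λ m n h k → ℚₚ.≤-trans
      (neg-nonexpansive (seq x m) (seq x n)) (proj₂ (cauchy x ε 0<ε) m n h k)

    abs-cauchy : ∀ x → IsCauchy (λ n → ℚ.∣ seq x n ∣)
    abs-cauchy x ε 0<ε = proj₁ (cauchy x ε 0<ε) , λ m n h k → ℚₚ.≤-trans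
      (abs-nonexpansive (seq x m) (seq x n)) (proj₂ (cauchy x ε 0<ε) m n h k)

    const-cauchy : ∀ q → IsCauchy (λ _ → q)
    const-cauchy q ε 0<ε = 0 , λ _ _ _ _ →
      subst (λ z → ℚ.∣ z ∣ ℚ.≤ ε) (sym (ℚₚ.+-inverseʳ q)) (ℚₚ.<⇒≤ 0<ε)

open Lemmas

infix  4 _≈_ _≤_ _<_
infix  8 -_
infixl 7 _*_ _⊓_
infixl 6 _+_ _-_

-- Opaque for the same reason; `unfolding` exposes the pointwise definitions.
opaque
  _+_ _*_ _⊓_ : ℝ → ℝ → ℝ
  x + y = mkℝ (λ n → seq x n ℚ.+ seq y n) (lift₂-cauchy ℚ._+_ +-nonexpansive x y)
  x ⊓ y = mkℝ (λ n → seq x n ℚ.⊓ seq y n) (lift₂-cauchy ℚ._⊓_ ⊓-nonexpansive x y)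
  x * y = mkℝ (λ n → seq x n ℚ.* seq y n) (*-cauchy x y)

  -_ abs : ℝ → ℝ
  - x   = mkℝ (λ n → ℚ.- seq x n)   (neg-cauchy x)
  abs x = mkℝ (λ n → ℚ.∣ seq x n ∣) (abs-cauchy x)

  _-_ : ℝ → ℝ → ℝ
  x - y = x + (- y)

  fromℚ : ℚ → ℝ
  fromℚ q = mkℝ (λ _ → q) (const-cauchy q)

  _≈_ _≤_ _<_ : ℝ → ℝ → Set
  x ≈ y = ∀ ε → 0ℚ ℚ.< ε → Eventually λ n → seq x n ⟶[ ε ] seq y n
  x ≤ y = ∀ ε → 0ℚ ℚ.< ε → Eventually λ n → seq x n ℚ.≤ seq y n ℚ.+ ε
  x < y = ∃ λ ε → 0ℚ ℚ.< ε × Eventually λ n → seq x n ℚ.+ ε ℚ.≤ seq y n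

fromℕ : ℕ → ℝ
fromℕ n = fromℚ (+ n ℚ./ 1)

0ℝ 1ℝ : ℝ
0ℝ = fromℚ 0ℚ
1ℝ = fromℚ 1ℚ

------------------------------------------------------------------------
-- Euclidean spaces

ℝ^_ : ℕ → Set
ℝ^ N = Vector ℝ N

sum : ∀ {n} → Vector ℝ n → ℝ
sum = Vector.foldr _+_ 0ℝ

infix  4 _≋_
infixr 7 _·_
infixl 6 _⊖_

_≋_ : ∀ {N} → ℝ^ N → ℝ^ N → Set
x ≋ y = ∀ i → x i ≈ y i

_⊖_ : ∀ {N} → ℝ^ N → ℝ^ N → ℝ^ N
_⊖_ = Vector.zipWith _-_

_·_ : ∀ {N} → ℝ → ℝ^ N → ℝ^ N
s · x = Vector.map (s *_) x

vsum : ∀ {n D} → (Fin n → ℝ^ D) → ℝ^ D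
vsum v i = sum λ c → v c i

⟨_,_⟩ : ∀ {N} → ℝ^ N → ℝ^ N → ℝ
⟨ x , y ⟩ = sum (Vector.zipWith _*_ x y)

‖_‖₁ ‖_‖₂² : ∀ {N} → ℝ^ N → ℝ
‖ x ‖₁  = sum (Vector.map abs x)
‖ x ‖₂² = ⟨ x , x ⟩

------------------------------------------------------------------------
-- Instances and integral solutions

data Problem : Set where
  k-median-ℓ₁ k-means-ℓ₂ : Problem

connection : Problem → ∀ {N} → ℝ^ N → ℝ^ N → ℝ
connection k-median-ℓ₁ p c = ‖ p ⊖ c ‖₁
connection k-means-ℓ₂  p c = ‖ p ⊖ c ‖₂²

-- The finite sets of candidate centers and of points are given by
-- enumerations without repetition; the two sets may intersect.
record Instance : Set where
  field
    dim #centers #points k : ℕ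
    center          : Fin #centers → ℝ^ dim
    point           : Fin #points → ℝ^ dim
    center-distinct : Injective _≡_ _≋_ center
    point-distinct  : Injective _≡_ _≋_ point

-- The seed f c₀ has c₀ ∈ C, so it does not affect the minimum.
minOver : ∀ {m} (C : Subset m) → Nonempty C → (Fin m → ℝ) → ℝ
minOver C (c₀ , _) f =
  List.foldr (λ c r → f c ⊓ r) (f c₀) (filter (_∈? C) (allFin _))

module _ (prob : Problem) (I : Instance) where
  open Instance I

  integralCost : (C : Subset #centers) → Nonempty C → ℝ
  integralCost C ne =
    sum λ p → minOver C ne λ c → connection prob (point p) (center c)

------------------------------------------------------------------------
-- The basic SDP relaxation, for n points, m candidate centers and
-- connection costs d

record SDPSolution (n m k : ℕ) : Set where
  field
    D  : ℕ
    v₀ : ℝ^ D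
    v  : Fin n → Fin m → ℝ^ D
    u  : Fin m → ℝ^ D
    v₀-unit     : ⟨ v₀ , v₀ ⟩ ≈ 1ℝ
    v-v₀        : ∀ p c → ⟨ v p c , v₀ ⟩ ≈ ‖ v p c ‖₂²
    u-v₀        : ∀ c → ⟨ u c , v₀ ⟩ ≈ ‖ u c ‖₂²
    v-u         : ∀ p c → ⟨ v p c , u c ⟩ ≈ ‖ v p c ‖₂²
    assignment  : ∀ p → ‖ vsum (v p) ⊖ v₀ ‖₂² ≈ 0ℝ
    cardinality : sum (λ c → ‖ u c ‖₂²) ≤ fromℕ k

module _ {n m : ℕ} (d : Fin n → Fin m → ℝ) where

  sdpCost : ∀ {k} → SDPSolution n m k → ℝ
  sdpCost S = sum λ p → sum λ c → ‖ v p c ‖₂² * d p c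
    where open SDPSolution S

  -- The infimum is attained: the feasible Gram matrices form a compact set.
  record IsSDPOptimum (k : ℕ) (opt : ℝ) : Set where
    field
      attained   : Σ (SDPSolution n m k) λ S → sdpCost S ≈ opt
      lowerBound : ∀ (S : SDPSolution n m k) → opt ≤ sdpCost S

module _ (prob : Problem) (I : Instance) where
  open Instance I

  IsSDPValue : ℝ → Set
  IsSDPValue = IsSDPOptimum (λ p c → connection prob (point p) (center c)) k

  -- Normalizing means rescaling space by s so that the optimal SDP cost,
  -- averaged over the points, becomes 1.  For k-means, distance at least 1
  -- is expressed by squared distance at least 1.
  WellSeparated : Set
  WellSeparated = ℕ.NonZero #points ×
    ∃ λ s → 0ℝ < s ×
      IsSDPOptimum
        (λ p c → connection prob (s · point p) (s · center c)) k (fromℕ #points) ×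
      (∀ (x y : Fin #points ⊎ Fin #centers) → ¬ (site x ≋ site y) →
        1ℝ ≤ connection prob (s · site x) (s · site y))
    where
    site : Fin #points ⊎ Fin #centers → ℝ^ dim
    site = [ point , center ]′

  -- The empty set of centers, whose cost would be +∞, is excluded.
  IntegralityGap : (ρ δ : ℝ) → Set
  IntegralityGap ρ δ = ∃ λ opt → IsSDPValue opt ×
    (∀ (C : Subset #centers) (ne : Nonempty C) →
      fromℕ ∣ C ∣ ≤ fromℕ k + δ * fromℕ k →
      ρ * opt ≤ integralCost prob I C ne)

{-# OPTIONS --safe #-}
module Submission where

-- The points are the edges e_i + e_j of a complete graph on n vertices, the
-- centers are its vertices e_c, and k = 2n/3.  In both problems an endpoint
-- of an edge serves it at cost 1 and every other vertex at cost 3.  All costs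
-- are at least 1 and Σ_c ‖v_{p,c}‖² = 1 in every feasible solution, so the
-- relaxation costs at least 1 per edge.  This is attained with orthogonal
-- fluctuations w_c: take u_c = (2/3) v₀ + w_c with ‖w_c‖² = 2/9, and assign
-- the edge ij half and half by v_{ij,i} = v₀/2 + z and v_{ij,j} = v₀/2 − z,
-- where z = (3/4)(w_i − w_j).
--
-- A set of at most (1 + 1/40) k centers misses at least 19n/60 vertices, and
-- each edge between missed vertices costs 3.  These are about (19/60)² ≈
-- 0.1003 of all edges, more than the 12/125 = 0.096 required since
-- 149/125 = 1 + 2·12/125.

open import Defs
open import Algebra.Bundles using (CommutativeRing)
open import Data.Bool using (Bool; true; false; not; _∧_; _xor_; if_then_else_)
open import Data.Bool.Properties using (xor-identityʳ; ∧-zeroʳ)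
open import Data.Nat as ℕ using (ℕ; zero; suc) renaming (_≤_ to _≤ⁿ_)
import Data.Nat.Properties as ℕₚ
import Data.Nat.Solver as ℕ-Solver
open import Data.Integer as ℤ using (+_)
import Data.Integer.Properties as ℤₚ
open import Data.Rational as ℚ using (ℚ; 0ℚ; 1ℚ; ½; _/_)
import Data.Rational.Properties as ℚₚ
open import Data.Rational.Solver using (module +-*-Solver)
import Data.Rational.Unnormalised as ℚᵘ
import Data.Rational.Unnormalised.Properties as ℚᵘₚ
open import Data.Fin using (Fin; zero; suc; _↑ˡ_; _↑ʳ_; splitAt)
import Data.Fin.Properties as Finₚ
open import Data.Fin.Subset using (Subset; ∣_∣; _∈_)
open import Data.Fin.Subset.Properties using (_∈?_)
open import Data.List as List using (filter; allFin)
open import Data.List.Relation.Unary.All using (All; []; _∷_)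
open import Data.List.Relation.Unary.All.Properties using (all-filter)
open import Data.Vec as Vec using (lookup)
open import Data.Vec.Properties using ([]=⇒lookup)
open import Data.Vec.Functional as Vector using (Vector)
import Data.Vec.Functional.Properties as Vectorₚ
open import Data.Product using (Σ; ∃; _×_; _,_)
open import Data.Sum using (_⊎_; inj₁; inj₂; [_,_]′)
open import Function using (_∘_; case_of_)
open import Relation.Nullary using (¬_; does)
open import Relation.Binary.PropositionalEquality
  using (_≡_; _≗_; refl; sym; trans; cong; cong₂; subst; subst₂; module ≡-Reasoning)

-- Finite sums of naturals and rationals

module ℕ∑ where
  open import Algebra.Properties.Semiring.Sum ℕₚ.+-*-semiring public
open ℕ∑ using () renaming (sum to ∑ⁿ)

module ℚ∑ where
  open import Algebra.Properties.Semiring.Sum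
    (CommutativeRing.semiring ℚₚ.+-*-commutativeRing) public
open ℚ∑ using () renaming (sum to ∑)

∑ⁿ-++ : ∀ m {n} (f : Vector ℕ (m ℕ.+ n)) →
  ∑ⁿ f ≡ ∑ⁿ (λ i → f (i ↑ˡ n)) ℕ.+ ∑ⁿ (λ i → f (m ↑ʳ i))
∑ⁿ-++ zero    f = refl
∑ⁿ-++ (suc m) f = trans (cong (f zero ℕ.+_) (∑ⁿ-++ m (f ∘ suc)))
  (sym (ℕₚ.+-assoc (f zero) _ _))

∑-++ : ∀ m {n} (f : Vector ℚ (m ℕ.+ n)) →
  ∑ f ≡ ∑ (λ i → f (i ↑ˡ n)) ℚ.+ ∑ (λ i → f (m ↑ʳ i))
∑-++ zero    f = sym (ℚₚ.+-identityˡ _)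
∑-++ (suc m) f = trans (cong (f zero ℚ.+_) (∑-++ m (f ∘ suc)))
  (sym (ℚₚ.+-assoc (f zero) _ _))

∑-mono : ∀ {n} {f g : Vector ℚ n} → (∀ i → f i ℚ.≤ g i) → ∑ f ℚ.≤ ∑ g
∑-mono {zero}  f≤g = ℚₚ.≤-refl
∑-mono {suc n} f≤g = ℚₚ.+-mono-≤ (f≤g zero) (∑-mono (f≤g ∘ suc))

square-nonneg : ∀ p → 0ℚ ℚ.≤ p ℚ.* p
square-nonneg p = subst (0ℚ ℚ.≤_) (abs-square (ℚₚ.∣p∣≡p∨∣p∣≡-p p))
  (subst (ℚ._≤ ℚ.∣ p ∣ ℚ.* ℚ.∣ p ∣) (ℚₚ.*-zeroʳ ℚ.∣ p ∣)
    (ℚₚ.*-monoˡ-≤-nonNeg ℚ.∣ p ∣ {{ℚ.nonNegative (ℚₚ.0≤∣p∣ p)}} (ℚₚ.0≤∣p∣ p)))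
  where
  open +-*-Solver
  abs-square : ℚ.∣ p ∣ ≡ p ⊎ ℚ.∣ p ∣ ≡ ℚ.- p → ℚ.∣ p ∣ ℚ.* ℚ.∣ p ∣ ≡ p ℚ.* p
  abs-square (inj₁ e) = cong (λ z → z ℚ.* z) e
  abs-square (inj₂ e) = trans (cong (λ z → z ℚ.* z) e)
    (solve 1 (λ p → (:- p) :* (:- p) := p :* p) refl p)

ι : ℕ → ℚ
ι n = + n / 1

-- Addition in `ℚ` renormalises fractions; in `ℚᵘ` the identity is an equation between integers.
ι-+ : ∀ m n → ι (m ℕ.+ n) ≡ ι m ℚ.+ ι n
ι-+ m n = ℚₚ.toℚᵘ-injective (begin
  ℚ.toℚᵘ (ι (m ℕ.+ n))              ≈⟨ ℚₚ.toℚᵘ-fromℚᵘ (ιᵘ (m ℕ.+ n)) ⟩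
  ιᵘ (m ℕ.+ n)                      ≈⟨ ℚᵘ.*≡* (cong₂ (λ a b → (a ℤ.+ b) ℤ.* + 1)
                                        (sym (ℤₚ.*-identityʳ (+ m))) (sym (ℤₚ.*-identityʳ (+ n)))) ⟩
  ιᵘ m ℚᵘ.+ ιᵘ n                    ≈⟨ ℚᵘₚ.+-cong (ℚₚ.toℚᵘ-fromℚᵘ (ιᵘ m)) (ℚₚ.toℚᵘ-fromℚᵘ (ιᵘ n)) ⟨
  ℚ.toℚᵘ (ι m) ℚᵘ.+ ℚ.toℚᵘ (ι n)    ≈⟨ ℚₚ.toℚᵘ-homo-+ (ι m) (ι n) ⟨
  ℚ.toℚᵘ (ι m ℚ.+ ι n)              ∎)
  where
  open ℚᵘₚ.≃-Reasoning
  ιᵘ : ℕ → ℚᵘ.ℚᵘ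
  ιᵘ n = ℚᵘ.mkℚᵘ (+ n) 0

ι-* : ∀ m n → ι (m ℕ.* n) ≡ ι m ℚ.* ι n
ι-* zero    n = sym (ℚₚ.*-zeroˡ (ι n))
ι-* (suc m) n = begin
  ι (n ℕ.+ m ℕ.* n)           ≡⟨ ι-+ n (m ℕ.* n) ⟩
  ι n ℚ.+ ι (m ℕ.* n)         ≡⟨ cong (ι n ℚ.+_) (ι-* m n) ⟩
  ι n ℚ.+ ι m ℚ.* ι n         ≡⟨ solve 2 (λ a b → b :+ a :* b
                                   := (con 1ℚ :+ a) :* b) refl (ι m) (ι n) ⟩
  (1ℚ ℚ.+ ι m) ℚ.* ι n        ≡⟨ cong (ℚ._* ι n) (ι-+ 1 m) ⟨
  ι (suc m) ℚ.* ι n           ∎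
  where open ≡-Reasoning; open +-*-Solver

0≤ι : ∀ n → 0ℚ ℚ.≤ ι n
0≤ι n = ℚₚ.nonNegative⁻¹ (ι n) {{ℚₚ.normalize-nonNeg n 1}}

ι-mono : ∀ {m n} → m ≤ⁿ n → ι m ℚ.≤ ι n
ι-mono {m} {n} m≤n = subst (λ z → ι m ℚ.≤ ι z) (ℕₚ.m+[n∸m]≡n m≤n)
  (subst (ι m ℚ.≤_) (sym (ι-+ m (n ℕ.∸ m))) (Lemmas.≤-+ʳ (ι m) _ (0≤ι (n ℕ.∸ m))))

-- A failure would put `ι m` at least 1 above `ι n`. This recovers inequalities of naturals from
-- real ones, which hold only up to a small error.
ι-cancel-½ : ∀ {m n} → ι m ℚ.≤ ι n ℚ.+ ½ → m ≤ⁿ n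
ι-cancel-½ {m} {n} h = ℕₚ.≮⇒≥ λ n<m → ℚₚ.<-irrefl refl (ℚₚ.<-≤-trans
  (ℚₚ.+-monoʳ-< (ι n) {½} {1ℚ} (ℚ.*<* (ℤ.+<+ (ℕ.s≤s (ℕ.s≤s ℕ.z≤n)))))
  (ℚₚ.≤-trans (ℚₚ.≤-reflexive (trans (ℚₚ.+-comm (ι n) 1ℚ) (sym (ι-+ 1 n))))
    (ℚₚ.≤-trans (ι-mono n<m) h)))

∑-ι : ∀ {n} (f : Vector ℕ n) → ∑ (ι ∘ f) ≡ ι (∑ⁿ f)
∑-ι {zero}  f = refl
∑-ι {suc n} f = trans (cong (ι (f zero) ℚ.+_) (∑-ι (f ∘ suc)))
  (sym (ι-+ (f zero) (∑ⁿ (f ∘ suc))))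

∑-const : ∀ n q → ∑ {n} (λ _ → q) ≡ ι n ℚ.* q
∑-const zero    q = sym (ℚₚ.*-zeroˡ q)
∑-const (suc n) q = begin
  q ℚ.+ ∑ {n} (λ _ → q)   ≡⟨ cong (q ℚ.+_) (∑-const n q) ⟩
  q ℚ.+ ι n ℚ.* q         ≡⟨ solve 2 (λ a b → b :+ a :* b := (con 1ℚ :+ a) :* b) refl (ι n) q ⟩
  (1ℚ ℚ.+ ι n) ℚ.* q      ≡⟨ cong (ℚ._* q) (ι-+ 1 n) ⟨
  ι (suc n) ℚ.* q         ∎
  where open ≡-Reasoning; open +-*-Solver

-- Real numbers, sequence by sequence

opaque
  unfolding _+_
  +-seq : ∀ x y t → seq (x + y) t ≡ seq x t ℚ.+ seq y t
  +-seq _ _ _ = refl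

  *-seq : ∀ x y t → seq (x * y) t ≡ seq x t ℚ.* seq y t
  *-seq _ _ _ = refl

  ⊓-seq : ∀ x y t → seq (x ⊓ y) t ≡ seq x t ℚ.⊓ seq y t
  ⊓-seq _ _ _ = refl

  minus-seq : ∀ x y t → seq (x - y) t ≡ seq x t ℚ.- seq y t
  minus-seq _ _ _ = refl

  abs-seq : ∀ x t → seq (abs x) t ≡ ℚ.∣ seq x t ∣
  abs-seq _ _ = refl

  fromℚ-seq : ∀ q t → seq (fromℚ q) t ≡ q
  fromℚ-seq _ _ = refl

  ≤-intro : ∀ {x y} →
    (∀ ε → 0ℚ ℚ.< ε → Eventually λ t → seq x t ℚ.≤ seq y t ℚ.+ ε) → x ≤ y
  ≤-intro h = h

  ≤-elim : ∀ {x y} → x ≤ y →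
    ∀ ε → 0ℚ ℚ.< ε → Eventually λ t → seq x t ℚ.≤ seq y t ℚ.+ ε
  ≤-elim h = h

  ≈⇒≤ : ∀ {x y} → x ≈ y → x ≤ y
  ≈⇒≤ {x} {y} h ε 0<ε = case h ε 0<ε of λ where
    (N , p) → N , λ t N≤t → Lemmas.shift (seq x t) (seq y t) (p t N≤t)

  ≈-sym : ∀ {x y} → x ≈ y → y ≈ x
  ≈-sym {x} {y} h ε 0<ε = case h ε 0<ε of λ where
    (N , p) → N , λ t N≤t →
      subst (ℚ._≤ ε) (Lemmas.dist-sym (seq x t) (seq y t)) (p t N≤t)

  seq-≡⇒≈ : ∀ {x y} → (∀ t → seq x t ≡ seq y t) → x ≈ y
  seq-≡⇒≈ {x} {y} h ε 0<ε = 0 , λ t _ → subst (λ z → ℚ.∣ z ∣ ℚ.≤ ε)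
    (sym (trans (cong (ℚ._- seq y t) (h t)) (ℚₚ.+-inverseʳ (seq y t)))) (ℚₚ.<⇒≤ 0<ε)

  0<⇒seq-nonneg : ∀ {x} → 0ℝ < x → Eventually λ t → 0ℚ ℚ.≤ seq x t
  0<⇒seq-nonneg {x} (ε , 0<ε , N , p) = N , λ t N≤t → ℚₚ.≤-trans (ℚₚ.<⇒≤ 0<ε)
    (subst (ℚ._≤ seq x t) (ℚₚ.+-identityˡ ε) (p t N≤t))

  fromℚ-pos : ∀ {q} → 0ℚ ℚ.< q → 0ℝ < fromℚ q
  fromℚ-pos {q} 0<q = q , 0<q , 0 , λ _ _ → ℚₚ.≤-reflexive (ℚₚ.+-identityˡ q)

infix 4 _≐_
-- Equality at every index, stronger than `_≈_`. All data of the instances are constant sequences,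
-- so statements about them become computations in `ℚ`.
_≐_ : ℝ → ℚ → Set
x ≐ q = ∀ t → seq x t ≡ q

≐⇒≈ : ∀ {x y q} → x ≐ q → y ≐ q → x ≈ y
≐⇒≈ h k = seq-≡⇒≈ λ t → trans (h t) (sym (k t))

Eventually-× : ∀ {P Q : ℕ → Set} → Eventually P → Eventually Q →
  Eventually λ t → P t × Q t
Eventually-× (M , p) (N , q) = M ℕ.⊔ N , λ t h →
  p t (ℕₚ.m⊔n≤o⇒m≤o M N h) , q t (ℕₚ.m⊔n≤o⇒n≤o M N h)

Eventually-map : ∀ {P Q : ℕ → Set} → (∀ t → P t → Q t) → Eventually P → Eventually Q
Eventually-map f (N , p) = N , λ t h → f t (p t h)

seq-≤⇒≤ : ∀ {x y} → Eventually (λ t → seq x t ℚ.≤ seq y t) → x ≤ y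
seq-≤⇒≤ {x} {y} h = ≤-intro λ ε 0<ε → Eventually-map
  (λ t x≤y → ℚₚ.≤-trans x≤y (Lemmas.≤-+ʳ (seq y t) ε (ℚₚ.<⇒≤ 0<ε))) h

≤-refl : ∀ {x} → x ≤ x
≤-refl = seq-≤⇒≤ (0 , λ _ _ → ℚₚ.≤-refl)

≤-trans : ∀ {x y z} → x ≤ y → y ≤ z → x ≤ z
≤-trans {x} {y} {z} h k = ≤-intro λ ε 0<ε → Eventually-map
  (λ { t (p , q) → ℚₚ.≤-trans p (ℚₚ.≤-trans (ℚₚ.+-monoˡ-≤ (½ ℚ.* ε) q)
    (ℚₚ.≤-reflexive (trans (ℚₚ.+-assoc (seq z t) _ _)
      (cong (seq z t ℚ.+_) (Lemmas.halves ε))))) })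
  (Eventually-× (≤-elim h (½ ℚ.* ε) (Lemmas.half-pos 0<ε))
                (≤-elim k (½ ℚ.* ε) (Lemmas.half-pos 0<ε)))

+-mono-≤ : ∀ {x y z w} → x ≤ y → z ≤ w → x + z ≤ y + w
+-mono-≤ {x} {y} {z} {w} h k = ≤-intro λ ε 0<ε → Eventually-map
  (λ { t (p , q) → subst₂ ℚ._≤_ (sym (+-seq x z t))
    (trans (solve 3 (λ a b e → (a :+ e) :+ (b :+ e) := (a :+ b) :+ (e :+ e)) refl
             (seq y t) (seq w t) (½ ℚ.* ε))
           (cong₂ ℚ._+_ (sym (+-seq y w t)) (Lemmas.halves ε)))
    (ℚₚ.+-mono-≤ p q) })
  (Eventually-× (≤-elim h (½ ℚ.* ε) (Lemmas.half-pos 0<ε))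
                (≤-elim k (½ ℚ.* ε) (Lemmas.half-pos 0<ε)))
  where open +-*-Solver

sum-mono : ∀ {n} {f g : ℝ^ n} → (∀ i → f i ≤ g i) → sum f ≤ sum g
sum-mono {zero}  h = ≤-refl
sum-mono {suc n} h = +-mono-≤ (h zero) (sum-mono (h ∘ suc))

sum-seq : ∀ {n} (f : ℝ^ n) t → seq (sum f) t ≡ ∑ λ i → seq (f i) t
sum-seq {zero}  f t = fromℚ-seq 0ℚ t
sum-seq {suc n} f t = trans (+-seq (f zero) (sum (f ∘ suc)) t)
  (cong (seq (f zero) t ℚ.+_) (sum-seq (f ∘ suc) t))

sum-≐ : ∀ {n} {f : ℝ^ n} {a : Vector ℚ n} → (∀ i → f i ≐ a i) → sum f ≐ ∑ a
sum-≐ {f = f} h t = trans (sum-seq f t) (ℚ∑.sum-cong-≗ λ i → h i t)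

⟨⟩-seq : ∀ {n} (x y : ℝ^ n) t → seq ⟨ x , y ⟩ t ≡ ∑ λ i → seq (x i) t ℚ.* seq (y i) t
⟨⟩-seq x y t = trans (sum-seq (Vector.zipWith _*_ x y) t) (ℚ∑.sum-cong-≗ λ i → *-seq (x i) (y i) t)

dot : ∀ {n} → Vector ℚ n → Vector ℚ n → ℚ
dot a b = ∑ λ i → a i ℚ.* b i

⟨⟩-≐ : ∀ {n} {x y : ℝ^ n} {a b : Vector ℚ n} →
  (∀ i → x i ≐ a i) → (∀ i → y i ≐ b i) → ⟨ x , y ⟩ ≐ dot a b
⟨⟩-≐ {x = x} {y} h k t = trans (⟨⟩-seq x y t)
  (ℚ∑.sum-cong-≗ λ i → cong₂ ℚ._*_ (h i t) (k i t))

-- The complete graph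

bit : Bool → ℕ
bit b = if b then 1 else 0

weight : ∀ {n} → Vector Bool n → ℕ
weight x = ∑ⁿ (bit ∘ x)

hamming : ∀ {n} → Vector Bool n → Vector Bool n → ℕ
hamming x y = ∑ⁿ λ l → bit (x l xor y l)

∑ⁿ-zero : ∀ n → ∑ⁿ {n} (λ _ → 0) ≡ 0
∑ⁿ-zero = ℕ∑.sum-replicate-zero

hamming≡0⇒≗ : ∀ {n} (x y : Vector Bool n) → hamming x y ≡ 0 → x ≗ y
hamming≡0⇒≗ {suc n} x y h zero with x zero | y zero
... | false | false = refl
... | true  | true  = refl
hamming≡0⇒≗ {suc n} x y h (suc i) =
  hamming≡0⇒≗ (x ∘ suc) (y ∘ suc) (ℕₚ.m+n≡0⇒n≡0 (bit (x zero xor y zero)) h) i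

𝟙 : ∀ {n} → Fin n → Vector Bool n
𝟙 i l = does (i Finₚ.≟ l)

𝟙-refl : ∀ {n} (i : Fin n) → 𝟙 i i ≡ true
𝟙-refl zero    = refl
𝟙-refl (suc i) = 𝟙-refl i

𝟙⇒≡ : ∀ {n} (i j : Fin n) → 𝟙 i j ≡ true → i ≡ j
𝟙⇒≡ zero    zero    _ = refl
𝟙⇒≡ (suc i) (suc j) h = cong suc (𝟙⇒≡ i j h)

𝟙-injective : ∀ {n} {i j : Fin n} → 𝟙 i ≗ 𝟙 j → i ≡ j
𝟙-injective {i = i} {j} h = sym (𝟙⇒≡ j i (trans (sym (h i)) (𝟙-refl i)))

weight-𝟙 : ∀ {n} (i : Fin n) → weight (𝟙 i) ≡ 1
weight-𝟙 {suc n} zero    = cong suc (∑ⁿ-zero n)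
weight-𝟙 {suc n} (suc i) = weight-𝟙 i

-- The test is `𝟙 j i` rather than `𝟙 i j` so that it matches an entry of `incidence`.
hamming-𝟙-𝟙 : ∀ {n} (i j : Fin n) → hamming (𝟙 i) (𝟙 j) ≡ (if 𝟙 j i then 0 else 2)
hamming-𝟙-𝟙 {suc n} zero    zero    = ∑ⁿ-zero n
hamming-𝟙-𝟙 {suc n} zero    (suc j) = cong suc (weight-𝟙 j)
hamming-𝟙-𝟙 {suc n} (suc i) zero    = cong suc (trans
  (ℕ∑.sum-cong-≗ λ l → cong bit (xor-identityʳ (𝟙 i l))) (weight-𝟙 i))
hamming-𝟙-𝟙 {suc n} (suc i) (suc j) = hamming-𝟙-𝟙 i j

-- Vertex `zero` is split off: its `n` edges to the other vertices come first, then the edges among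
-- the others.
#edges : ℕ → ℕ
#edges zero    = 0
#edges (suc n) = n ℕ.+ #edges n

-- The count n(n - 1)/2, free of subtraction and division.
#edges-double : ∀ n → 2 ℕ.* #edges n ℕ.+ n ≡ n ℕ.* n
#edges-double zero    = refl
#edges-double (suc n) = begin
  2 ℕ.* (n ℕ.+ #edges n) ℕ.+ suc n
    ≡⟨ solve 2 (λ n e → con 2 :* (n :+ e) :+ (con 1 :+ n)
         := (con 2 :* e :+ n) :+ (con 1 :+ con 2 :* n)) refl n (#edges n) ⟩
  (2 ℕ.* #edges n ℕ.+ n) ℕ.+ (1 ℕ.+ 2 ℕ.* n)
    ≡⟨ cong (ℕ._+ (1 ℕ.+ 2 ℕ.* n)) (#edges-double n) ⟩
  n ℕ.* n ℕ.+ (1 ℕ.+ 2 ℕ.* n)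
    ≡⟨ solve 1 (λ n → n :* n :+ (con 1 :+ con 2 :* n) := (con 1 :+ n) :* (con 1 :+ n)) refl n ⟩
  suc n ℕ.* suc n ∎
  where open ≡-Reasoning; open ℕ-Solver.+-*-Solver

#edges-nonZero : ∀ {n} → 2 ≤ⁿ n → ℕ.NonZero (#edges n)
#edges-nonZero (ℕ.s≤s (ℕ.s≤s _)) = _

-- The vector e_i + e_j of an edge ij, following the order of edges in `#edges`.
incidence : ∀ n → Fin (#edges n) → Vector Bool n
incidence (suc n) e =
  [ (λ j → true Vector.∷ 𝟙 j) , (λ e′ → false Vector.∷ incidence n e′) ]′ (splitAt n e)

incidence-injective : ∀ n {e e′} → incidence n e ≗ incidence n e′ → e ≡ e′
incidence-injective (suc n) {e} {e′} h with splitAt n e in p | splitAt n e′ in q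
... | inj₁ i | inj₁ j = trans (sym (Finₚ.splitAt⁻¹-↑ˡ p)) (trans
  (cong (_↑ˡ #edges n) (𝟙-injective (h ∘ suc))) (Finₚ.splitAt⁻¹-↑ˡ q))
... | inj₂ i | inj₂ j = trans (sym (Finₚ.splitAt⁻¹-↑ʳ p)) (trans
  (cong (n ↑ʳ_) (incidence-injective n (h ∘ suc))) (Finₚ.splitAt⁻¹-↑ʳ q))
-- Coordinate `zero` tells the edges at vertex `zero` from the others.
... | inj₁ i | inj₂ j = case h zero of λ ()
... | inj₂ i | inj₁ j = case h zero of λ ()

weight-incidence : ∀ n e → weight (incidence n e) ≡ 2
weight-incidence (suc n) e with splitAt n e
... | inj₁ j  = cong suc (weight-𝟙 j)
... | inj₂ e′ = weight-incidence n e′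

-- The weights 1 and 2 add up to 3; if `c` is an endpoint, the common coordinate cancels on both
-- sides and leaves 1.
hamming-𝟙-incidence : ∀ n e c →
  hamming (𝟙 c) (incidence n e) ≡ (if incidence n e c then 1 else 3)
hamming-𝟙-incidence (suc n) e c with splitAt n e
hamming-𝟙-incidence (suc n) e zero    | inj₁ j  = weight-𝟙 j
hamming-𝟙-incidence (suc n) e (suc c) | inj₁ j  with 𝟙 j c | hamming-𝟙-𝟙 c j
... | true  | h = cong suc h
... | false | h = cong suc h
hamming-𝟙-incidence (suc n) e zero    | inj₂ e′ = cong suc (weight-incidence n e′)
hamming-𝟙-incidence (suc n) e (suc c) | inj₂ e′ = hamming-𝟙-incidence n e′ c

-- The edge set of the subgraph induced on `x`, by the same recursion as `incidence` so that one
-- case split serves both.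
induced : ∀ n → Vector Bool n → Fin (#edges n) → Bool
induced (suc n) x e =
  [ (λ j → x zero ∧ x (suc j)) , induced n (x ∘ suc) ]′ (splitAt n e)

-- An edge with an opened endpoint is thus never counted among the edges between missed vertices.
induced-incident : ∀ n x e c → incidence n e c ≡ true → x c ≡ false → induced n x e ≡ false
induced-incident (suc n) x e c h k with splitAt n e
induced-incident (suc n) x e zero    h k | inj₁ j rewrite k = refl
induced-incident (suc n) x e (suc c) h k | inj₁ j with refl ← 𝟙⇒≡ j c h rewrite k = ∧-zeroʳ (x zero)
induced-incident (suc n) x e (suc c) h k | inj₂ e′ = induced-incident n (x ∘ suc) e′ c h k

-- The ordered pairs of marked vertices are the diagonal ones and each induced edge twice. In the
-- induction, vertex `zero` with bit a adds a·w edges, where w is the weight of the rest.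
induced-count : ∀ n x → 2 ℕ.* weight (induced n x) ℕ.+ weight x ≡ weight x ℕ.* weight x
induced-count zero    x = refl
induced-count (suc n) x = begin
  2 ℕ.* weight (induced (suc n) x) ℕ.+ (bit (x zero) ℕ.+ w)
    ≡⟨ cong (λ z → 2 ℕ.* z ℕ.+ (bit (x zero) ℕ.+ w)) split ⟩
  2 ℕ.* (bit (x zero) ℕ.* w ℕ.+ u) ℕ.+ (bit (x zero) ℕ.+ w)
    ≡⟨ solve 3 (λ a w u → con 2 :* (a :* w :+ u) :+ (a :+ w)
         := (con 2 :* u :+ w) :+ (con 2 :* (a :* w) :+ a)) refl (bit (x zero)) w u ⟩
  (2 ℕ.* u ℕ.+ w) ℕ.+ (2 ℕ.* (bit (x zero) ℕ.* w) ℕ.+ bit (x zero))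
    ≡⟨ cong₂ (λ y z → y ℕ.+ (2 ℕ.* (bit (x zero) ℕ.* w) ℕ.+ z))
         (induced-count n (x ∘ suc)) (bit-idem (x zero)) ⟩
  w ℕ.* w ℕ.+ (2 ℕ.* (bit (x zero) ℕ.* w) ℕ.+ bit (x zero) ℕ.* bit (x zero))
    ≡⟨ solve 2 (λ a w → w :* w :+ (con 2 :* (a :* w) :+ a :* a)
         := (a :+ w) :* (a :+ w)) refl (bit (x zero)) w ⟩
  (bit (x zero) ℕ.+ w) ℕ.* (bit (x zero) ℕ.+ w) ∎
  where
  open ≡-Reasoning
  open ℕ-Solver.+-*-Solver
  w u : ℕ
  w = weight (x ∘ suc)
  u = weight (induced n (x ∘ suc))
  -- Replacing a by a² completes the square (a + w)².
  bit-idem : ∀ b → bit b ≡ bit b ℕ.* bit b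
  bit-idem true  = refl
  bit-idem false = refl
  bit-∧ : ∀ a b → bit (a ∧ b) ≡ bit a ℕ.* bit b
  bit-∧ true  b = sym (ℕₚ.+-identityʳ (bit b))
  bit-∧ false b = refl
  split : weight (induced (suc n) x) ≡ bit (x zero) ℕ.* w ℕ.+ u
  split = trans (∑ⁿ-++ n (bit ∘ induced (suc n) x)) (cong₂ ℕ._+_
    (trans (ℕ∑.sum-cong-≗ λ j → trans
        (cong (bit ∘ [ _ , _ ]′) (Finₚ.splitAt-↑ˡ n j (#edges n)))
        (bit-∧ (x zero) (x (suc j))))
      (sym (ℕ∑.*-distribˡ-sum (bit (x zero)) (bit ∘ x ∘ suc))))
    (ℕ∑.sum-cong-≗ λ e → cong (bit ∘ [ _ , _ ]′) (Finₚ.splitAt-↑ʳ n (#edges n) e)))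

weight-complement : ∀ {n} (C : Subset n) → ∣ C ∣ ℕ.+ weight (not ∘ lookup C) ≡ n
weight-complement Vec.[]            = refl
weight-complement (true Vec.∷ C)  = cong suc (weight-complement C)
weight-complement (false Vec.∷ C) = trans (ℕₚ.+-suc ∣ C ∣ _) (cong suc (weight-complement C))

-- Points and centers in the Hamming cube

⟦_⟧ : Bool → ℚ
⟦ b ⟧ = ι (bit b)

-- For bits a and b, |a - b| and (a - b)² coincide, so both problems have the Hamming distance as
-- cost and are treated together from here on.
connection-≐ : ∀ prob {N} (x y : ℝ^ N) (a b : Vector Bool N) →
  (∀ i → x i ≐ ⟦ a i ⟧) → (∀ i → y i ≐ ⟦ b i ⟧) →
  connection prob x y ≐ ι (hamming b a)
connection-≐ prob x y a b hx hy t =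
  trans (pointwise prob t) (∑-ι λ i → bit (b i xor a i))
  where
  abs-difference : ∀ a b → ℚ.∣ ⟦ a ⟧ ℚ.- ⟦ b ⟧ ∣ ≡ ⟦ b xor a ⟧
  abs-difference true  true  = refl
  abs-difference true  false = refl
  abs-difference false true  = refl
  abs-difference false false = refl

  square-difference : ∀ a b →
    (⟦ a ⟧ ℚ.- ⟦ b ⟧) ℚ.* (⟦ a ⟧ ℚ.- ⟦ b ⟧) ≡ ⟦ b xor a ⟧
  square-difference true  true  = refl
  square-difference true  false = refl
  square-difference false true  = refl
  square-difference false false = refl

  pointwise : ∀ prob t → seq (connection prob x y) t ≡ ∑ λ i → ⟦ b i xor a i ⟧
  pointwise k-median-ℓ₁ = sum-≐ λ i t → trans (abs-seq (x i - y i) t)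
    (trans (cong ℚ.∣_∣ (trans (minus-seq (x i) (y i) t) (cong₂ ℚ._-_ (hx i t) (hy i t))))
      (abs-difference (a i) (b i)))
  pointwise k-means-ℓ₂  = sum-≐ λ i t → trans (*-seq (x i - y i) (x i - y i) t)
    (trans (cong (λ z → z ℚ.* z) (trans (minus-seq (x i) (y i) t) (cong₂ ℚ._-_ (hx i t) (hy i t))))
      (square-difference (a i) (b i)))

-- The lower bound on the relaxation

-- From ‖ (x − y) + η y ‖² ≥ 0.
dot-perturb : ∀ {n} (x y : Vector ℚ n) η →
  (η ℚ.+ η) ℚ.* dot y y ℚ.≤
  (η ℚ.+ η) ℚ.* dot x y ℚ.+ (dot (λ i → x i ℚ.- y i) (λ i → x i ℚ.- y i) ℚ.+ (η ℚ.* η) ℚ.* dot y y)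
dot-perturb {zero}  x y η = ℚₚ.≤-reflexive (solve 1 (λ h →
  (h :+ h) :* con 0ℚ := (h :+ h) :* con 0ℚ :+ (con 0ℚ :+ (h :* h) :* con 0ℚ)) refl η)
  where open +-*-Solver
dot-perturb {suc n} x y η = subst₂ ℚ._≤_
  (solve 3 (λ h b B → (h :+ h) :* (b :* b) :+ (h :+ h) :* B := (h :+ h) :* (b :* b :+ B)) refl
    η y₀ (dot (y ∘ suc) (y ∘ suc)))
  (solve 6 (λ h a b A B D →
    ((h :+ h) :* (b :* b) :+ ((a :- b) :+ h :* b) :* ((a :- b) :+ h :* b))
      :+ ((h :+ h) :* A :+ (D :+ (h :* h) :* B))
    := (h :+ h) :* (a :* b :+ A) :+ (((a :- b) :* (a :- b) :+ D) :+ (h :* h) :* (b :* b :+ B))) refl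
    η x₀ y₀ (dot (x ∘ suc) (y ∘ suc)) (dot (y ∘ suc) (y ∘ suc)) (dot δ δ))
  (ℚₚ.+-mono-≤ (Lemmas.≤-+ʳ ((η ℚ.+ η) ℚ.* (y₀ ℚ.* y₀)) _
                  (square-nonneg ((x₀ ℚ.- y₀) ℚ.+ η ℚ.* y₀)))
    (dot-perturb (x ∘ suc) (y ∘ suc) η))
  where
  open +-*-Solver
  x₀ y₀ : ℚ
  x₀ = x zero
  y₀ = y zero
  δ : Vector ℚ n
  δ i = x (suc i) ℚ.- y (suc i)

∑-nonneg : ∀ {n} {f : Vector ℚ n} → (∀ i → 0ℚ ℚ.≤ f i) → 0ℚ ℚ.≤ ∑ f
∑-nonneg {zero}  h = ℚₚ.≤-refl
∑-nonneg {suc n} h = ℚₚ.+-mono-≤ (h zero) (∑-nonneg (h ∘ suc))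

‖‖²-nonneg : ∀ {n} (x : ℝ^ n) t → 0ℚ ℚ.≤ seq ‖ x ‖₂² t
‖‖²-nonneg x t = subst (0ℚ ℚ.≤_) (sym (⟨⟩-seq x x t)) (∑-nonneg λ i → square-nonneg (seq (x i) t))

⟨vsum,⟩-seq : ∀ {m D} (v : Fin m → ℝ^ D) (y : ℝ^ D) t →
  seq (sum λ c → ⟨ v c , y ⟩) t ≡ dot (λ i → seq (vsum v i) t) (λ i → seq (y i) t)
⟨vsum,⟩-seq v y t = begin
  seq (sum λ c → ⟨ v c , y ⟩) t
    ≡⟨ trans (sum-seq (λ c → ⟨ v c , y ⟩) t) (ℚ∑.sum-cong-≗ λ c → ⟨⟩-seq (v c) y t) ⟩
  ∑ (λ c → ∑ λ i → seq (v c i) t ℚ.* seq (y i) t)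
    ≡⟨ ℚ∑.∑-comm (λ c i → seq (v c i) t ℚ.* seq (y i) t) ⟩
  ∑ (λ i → ∑ λ c → seq (v c i) t ℚ.* seq (y i) t)
    ≡⟨ ℚ∑.sum-cong-≗ (λ i → trans (sym (ℚ∑.*-distribʳ-sum (seq (y i) t) (λ c → seq (v c i) t)))
         (cong (ℚ._* seq (y i) t) (sym (sum-seq (λ c → v c i) t)))) ⟩
  dot (λ i → seq (vsum v i) t) (λ i → seq (y i) t) ∎
  where open ≡-Reasoning

-- The masses sum to ⟨Σ v_c, v₀⟩, and Σ v_c is v₀ up to a vanishing residual. Cauchy-Schwarz would
-- require square roots; `dot-perturb` divided by 2η replaces it.
assignment-mass : ∀ {m D} (v : Fin m → ℝ^ D) (v₀ : ℝ^ D) → ⟨ v₀ , v₀ ⟩ ≈ 1ℝ →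
  (∀ c → ⟨ v c , v₀ ⟩ ≈ ‖ v c ‖₂²) → ‖ vsum v ⊖ v₀ ‖₂² ≈ 0ℝ →
  1ℝ ≤ sum λ c → ‖ v c ‖₂²
assignment-mass v v₀ unit proj assign = ≤-intro λ ε 0<ε →
  -- The chain in `conclude` loses η, then 2η, then η, hence η = ε/4.
  let η   = ½ ℚ.* (½ ℚ.* ε)
      0<η = Lemmas.half-pos (Lemmas.half-pos 0<ε)
      0<η² = subst (ℚ._< η ℚ.* η) (ℚₚ.*-zeroʳ η) (ℚₚ.*-monoʳ-<-pos η {{ℚ.positive 0<η}} 0<η)
  in Eventually-map
    (λ { t ((V≤2 , 1≤V) , (Y≤ , B≤N)) → conclude ε η t 0<η refl V≤2 1≤V Y≤ B≤N })
    (Eventually-× (Eventually-× (≤-elim (≈⇒≤ unit) 1ℚ (ℚₚ.positive⁻¹ 1ℚ))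
                                (≤-elim (≈⇒≤ (≈-sym unit)) η 0<η))
                  -- The residual is later divided by 2η, so it has to be of order η².
                  (Eventually-× (≤-elim (≈⇒≤ assign) (η ℚ.* η) 0<η²)
                                (≤-elim (sum-mono λ c → ≈⇒≤ (proj c)) η 0<η)))
  where
  V Y B N : ℕ → ℚ
  V t = seq ⟨ v₀ , v₀ ⟩ t
  Y t = seq ‖ vsum v ⊖ v₀ ‖₂² t
  B t = seq (sum λ c → ⟨ v c , v₀ ⟩) t
  N t = seq (sum λ c → ‖ v c ‖₂²) t

  perturb : ∀ η t → (η ℚ.+ η) ℚ.* V t ℚ.≤ (η ℚ.+ η) ℚ.* B t ℚ.+ (Y t ℚ.+ (η ℚ.* η) ℚ.* V t)
  perturb η t
    rewrite ⟨⟩-seq v₀ v₀ t | ⟨vsum,⟩-seq v v₀ t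
          | trans (⟨⟩-seq (vsum v ⊖ v₀) (vsum v ⊖ v₀) t)
              (ℚ∑.sum-cong-≗ λ i → cong (λ z → z ℚ.* z) (minus-seq (vsum v i) (v₀ i) t))
    = dot-perturb (λ i → seq (vsum v i) t) (λ i → seq (v₀ i) t) η

  conclude : ∀ ε η t → 0ℚ ℚ.< η → η ≡ ½ ℚ.* (½ ℚ.* ε) →
    V t ℚ.≤ seq 1ℝ t ℚ.+ 1ℚ → seq 1ℝ t ℚ.≤ V t ℚ.+ η →
    Y t ℚ.≤ seq 0ℝ t ℚ.+ η ℚ.* η → B t ℚ.≤ N t ℚ.+ η →
    seq 1ℝ t ℚ.≤ N t ℚ.+ ε
  conclude ε η t 0<η η≡ V≤2 1≤V Y≤η² B≤N rewrite fromℚ-seq 1ℚ t | fromℚ-seq 0ℚ t = begin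
    1ℚ                       ≤⟨ 1≤V ⟩
    V t ℚ.+ η                ≤⟨ ℚₚ.+-monoˡ-≤ η V≤B+2η ⟩
    B t ℚ.+ (η ℚ.+ η) ℚ.+ η  ≤⟨ ℚₚ.+-monoˡ-≤ η (ℚₚ.+-monoˡ-≤ (η ℚ.+ η) B≤N) ⟩
    N t ℚ.+ η ℚ.+ (η ℚ.+ η) ℚ.+ η
      ≡⟨ cong (λ η → N t ℚ.+ η ℚ.+ (η ℚ.+ η) ℚ.+ η) η≡ ⟩
    N t ℚ.+ ¼ε ℚ.+ (¼ε ℚ.+ ¼ε) ℚ.+ ¼ε
      ≡⟨ solve 2 (λ a e → a :+ e :+ (e :+ e) :+ e := a :+ ((e :+ e) :+ (e :+ e))) refl (N t) ¼ε ⟩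
    N t ℚ.+ ((¼ε ℚ.+ ¼ε) ℚ.+ (¼ε ℚ.+ ¼ε))
      ≡⟨ cong (N t ℚ.+_) (trans (cong (λ z → z ℚ.+ z) (Lemmas.halves (½ ℚ.* ε)))
           (Lemmas.halves ε)) ⟩
    N t ℚ.+ ε ∎
    where
    open ℚₚ.≤-Reasoning
    open +-*-Solver
    ¼ε : ℚ
    ¼ε = ½ ℚ.* (½ ℚ.* ε)
    V≤B+2η : V t ℚ.≤ B t ℚ.+ (η ℚ.+ η)
    V≤B+2η = ℚₚ.*-cancelˡ-≤-pos (η ℚ.+ η) {{ℚ.positive (ℚₚ.+-mono-< 0<η 0<η)}} (begin
      (η ℚ.+ η) ℚ.* V t                                             ≤⟨ perturb η t ⟩
      (η ℚ.+ η) ℚ.* B t ℚ.+ (Y t ℚ.+ (η ℚ.* η) ℚ.* V t)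
        ≤⟨ ℚₚ.+-monoʳ-≤ ((η ℚ.+ η) ℚ.* B t) (ℚₚ.+-mono-≤ Y≤η²
             (ℚₚ.*-monoˡ-≤-nonNeg (η ℚ.* η) {{ℚ.nonNegative (square-nonneg η)}} V≤2)) ⟩
      (η ℚ.+ η) ℚ.* B t ℚ.+ ((0ℚ ℚ.+ η ℚ.* η) ℚ.+ (η ℚ.* η) ℚ.* (1ℚ ℚ.+ 1ℚ))
        -- One more η² rounds the error 3η² up to 4η², which is 2η times 2η.
        ≤⟨ Lemmas.≤-+ʳ _ (η ℚ.* η) (square-nonneg η) ⟩
      (η ℚ.+ η) ℚ.* B t ℚ.+ ((0ℚ ℚ.+ η ℚ.* η) ℚ.+ (η ℚ.* η) ℚ.* (1ℚ ℚ.+ 1ℚ)) ℚ.+ η ℚ.* η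
        ≡⟨ solve 2 (λ h b → (h :+ h) :* b :+ ((con 0ℚ :+ h :* h) :+ (h :* h) :* (con 1ℚ :+ con 1ℚ)) :+ h :* h
             := (h :+ h) :* (b :+ (h :+ h))) refl η (B t) ⟩
      (η ℚ.+ η) ℚ.* (B t ℚ.+ (η ℚ.+ η)) ∎)

-- Each point has mass at least 1, charged at cost at least 1. The bound on `d` is required at every
-- index, so costs are compared index by index.
sdp-lowerBound : ∀ {n m k} (d : Fin n → Fin m → ℝ) → (∀ p c t → 1ℚ ℚ.≤ seq (d p c) t) →
  (S : SDPSolution n m k) → fromℕ n ≤ sdpCost d S
sdp-lowerBound {n} d 1≤d S = ≤-trans
  (≈⇒≤ (≐⇒≈ (fromℚ-seq (ι n)) (λ t → trans (sum-≐ {n} {λ _ → 1ℝ} (λ _ → fromℚ-seq 1ℚ) t)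
    (trans (∑-const n 1ℚ) (ℚₚ.*-identityʳ (ι n))))))
  (sum-mono λ p → ≤-trans (assignment-mass (v p) v₀ v₀-unit (v-v₀ p) (assignment p))
    (sum-mono λ c → seq-≤⇒≤ (0 , λ t _ → mass≤cost p c t)))
  where
  open SDPSolution S
  mass≤cost : ∀ p c t → seq ‖ v p c ‖₂² t ℚ.≤ seq (‖ v p c ‖₂² * d p c) t
  mass≤cost p c t = begin
    seq ‖ v p c ‖₂² t                    ≡⟨ ℚₚ.*-identityʳ _ ⟨
    seq ‖ v p c ‖₂² t ℚ.* 1ℚ             ≤⟨ ℚₚ.*-monoˡ-≤-nonNeg (seq ‖ v p c ‖₂² t)
                                              {{ℚ.nonNegative (‖‖²-nonneg (v p c) t)}} (1≤d p c t) ⟩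
    seq ‖ v p c ‖₂² t ℚ.* seq (d p c) t  ≡⟨ *-seq ‖ v p c ‖₂² (d p c) t ⟨
    seq (‖ v p c ‖₂² * d p c) t          ∎
    where open ℚₚ.≤-Reasoning

-- The optimal solution of the relaxation

-- Writing every graph coordinate twice makes the norms below rational: a
-- single copy would need the factor √2.
augment : ∀ {n} → ℚ → Vector ℚ n → Vector ℚ (suc (n ℕ.+ n))
augment a x = a Vector.∷ (x Vector.++ x)

dot-augment : ∀ {n} a b (x y : Vector ℚ n) →
  dot (augment a x) (augment b y) ≡ a ℚ.* b ℚ.+ (dot x y ℚ.+ dot x y)
dot-augment {n} a b x y = cong (a ℚ.* b ℚ.+_) (trans
  (∑-++ n (λ i → (x Vector.++ x) i ℚ.* (y Vector.++ y) i))
  (cong₂ ℚ._+_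
    (ℚ∑.sum-cong-≗ λ i → cong₂ ℚ._*_ (Vectorₚ.lookup-++ˡ x x i) (Vectorₚ.lookup-++ˡ y y i))
    (ℚ∑.sum-cong-≗ λ i → cong₂ ℚ._*_ (Vectorₚ.lookup-++ʳ x x i) (Vectorₚ.lookup-++ʳ y y i))))

∑-augment : ∀ {m n} (a : Vector ℚ m) (x : Fin m → Vector ℚ n) i →
  ∑ (λ c → augment (a c) (x c) i) ≡ augment (∑ a) (λ l → ∑ λ c → x c l) i
∑-augment a x zero = refl
∑-augment {n = n} a x (suc i) with splitAt n i
... | inj₁ _ = refl
... | inj₂ _ = refl

augment-cong : ∀ {n a b} {x y : Vector ℚ n} → a ≡ b → x ≗ y → augment a x ≗ augment b y
augment-cong a≡b x≗y zero = a≡b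
augment-cong {n} a≡b x≗y (suc i) with splitAt n i
... | inj₁ j = x≗y j
... | inj₂ j = x≗y j

∑-𝟙* : ∀ {n} (c : Fin n) (f : Vector ℚ n) → ∑ (λ l → ⟦ 𝟙 c l ⟧ ℚ.* f l) ≡ f c
∑-𝟙* {suc n} zero f = begin
  1ℚ ℚ.* f zero ℚ.+ ∑ (λ l → 0ℚ ℚ.* f (suc l))
    ≡⟨ cong₂ ℚ._+_ (ℚₚ.*-identityˡ (f zero))
         (trans (ℚ∑.sum-cong-≗ λ l → ℚₚ.*-zeroˡ (f (suc l))) (ℚ∑.sum-replicate-zero n)) ⟩
  f zero ℚ.+ 0ℚ ≡⟨ ℚₚ.+-identityʳ (f zero) ⟩
  f zero ∎
  where open ≡-Reasoning
∑-𝟙* {suc n} (suc c) f = trans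
  (cong₂ ℚ._+_ (ℚₚ.*-zeroˡ (f zero)) (∑-𝟙* c (f ∘ suc))) (ℚₚ.+-identityˡ (f (suc c)))

𝟙-sym : ∀ {n} (i j : Fin n) → 𝟙 i j ≡ 𝟙 j i
𝟙-sym zero    zero    = refl
𝟙-sym zero    (suc j) = refl
𝟙-sym (suc i) zero    = refl
𝟙-sym (suc i) (suc j) = 𝟙-sym i j

∑-incidence : ∀ n e → ∑ (λ l → ⟦ incidence n e l ⟧) ≡ ι 2
∑-incidence n e = trans (∑-ι (bit ∘ incidence n e)) (cong ι (weight-incidence n e))

-- Bits equal their squares, so the coordinate products below are combinations of δ, p and δp. These
-- sum to 1, to 2 and to the incidence of `c` with `e`.
∑-form : ∀ n e c a b g →
  ∑ (λ l → (a ℚ.* ⟦ 𝟙 c l ⟧ ℚ.+ b ℚ.* ⟦ incidence n e l ⟧)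
           ℚ.+ g ℚ.* (⟦ 𝟙 c l ⟧ ℚ.* ⟦ incidence n e l ⟧))
  ≡ (a ℚ.+ b ℚ.* ι 2) ℚ.+ g ℚ.* ⟦ incidence n e c ⟧
∑-form n e c a b g = begin
  ∑ (λ l → (a ℚ.* δ l ℚ.+ b ℚ.* p l) ℚ.+ g ℚ.* (δ l ℚ.* p l))
    ≡⟨ ℚ∑.∑-distrib-+ (λ l → a ℚ.* δ l ℚ.+ b ℚ.* p l) (λ l → g ℚ.* (δ l ℚ.* p l)) ⟩
  ∑ (λ l → a ℚ.* δ l ℚ.+ b ℚ.* p l) ℚ.+ ∑ (λ l → g ℚ.* (δ l ℚ.* p l))
    ≡⟨ cong (ℚ._+ ∑ (λ l → g ℚ.* (δ l ℚ.* p l)))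
         (ℚ∑.∑-distrib-+ (λ l → a ℚ.* δ l) (λ l → b ℚ.* p l)) ⟩
  (∑ (λ l → a ℚ.* δ l) ℚ.+ ∑ (λ l → b ℚ.* p l)) ℚ.+ ∑ (λ l → g ℚ.* (δ l ℚ.* p l))
    ≡⟨ cong₂ ℚ._+_ (cong₂ ℚ._+_
         (trans (ℚ∑.sum-cong-≗ λ l → ℚₚ.*-comm a (δ l)) (∑-𝟙* c (λ _ → a)))
         (trans (sym (ℚ∑.*-distribˡ-sum b p)) (cong (b ℚ.*_) (∑-incidence n e))))
         (trans (sym (ℚ∑.*-distribˡ-sum g (λ l → δ l ℚ.* p l))) (cong (g ℚ.*_) (∑-𝟙* c p))) ⟩
  (a ℚ.+ b ℚ.* ι 2) ℚ.+ g ℚ.* p c ∎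
  where
  open ≡-Reasoning
  δ p : Vector ℚ n
  δ l = ⟦ 𝟙 c l ⟧
  p l = ⟦ incidence n e l ⟧

⅓ ⅔ ¼ : ℚ
⅓ = + 1 / 3
⅔ = + 2 / 3
¼ = + 1 / 4

module CompleteGraphSDP (n : ℕ) where

  -- One copy of w_c; two copies give the squared norm 2/9.
  U : Fin n → Vector ℚ n
  U c l = ⅓ ℚ.* ⟦ 𝟙 c l ⟧

  -- One copy of ±z without naming the endpoints: at c = i it is (e_i - e_j)/4, which is 3/4 of the
  -- difference of `U i` and `U j`, and at c = j its negative.
  V : Fin (#edges n) → Fin n → Vector ℚ n
  V e c l = ⟦ incidence n e c ⟧ ℚ.* (½ ℚ.* ⟦ 𝟙 c l ⟧ ℚ.- ¼ ℚ.* ⟦ incidence n e l ⟧)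

  v₀′ : Vector ℚ (suc (n ℕ.+ n))
  v₀′ = augment {n} 1ℚ (λ _ → 0ℚ)

  u′ : Fin n → Vector ℚ (suc (n ℕ.+ n))
  u′ c = augment ⅔ (U c)

  v′ : Fin (#edges n) → Fin n → Vector ℚ (suc (n ℕ.+ n))
  v′ e c = augment (⟦ incidence n e c ⟧ ℚ.* ½) (V e c)

  dot-zeroʳ : ∀ {m} (x : Vector ℚ m) → dot x (λ _ → 0ℚ) ≡ 0ℚ
  dot-zeroʳ {m} x = trans (ℚ∑.sum-cong-≗ λ i → ℚₚ.*-zeroʳ (x i)) (ℚ∑.sum-replicate-zero m)

  dot-v₀′ : ∀ a (x : Vector ℚ n) → dot (augment a x) v₀′ ≡ a
  dot-v₀′ a x = trans (dot-augment a 1ℚ x (λ _ → 0ℚ)) (trans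
    (cong₂ (λ y z → a ℚ.* 1ℚ ℚ.+ (y ℚ.+ z)) (dot-zeroʳ x) (dot-zeroʳ x))
    (solve 1 (λ a → a :* con 1ℚ :+ (con 0ℚ :+ con 0ℚ) := a) refl a))
    where open +-*-Solver

  dot-U-U : ∀ c → dot (U c) (U c) ≡ + 1 / 9
  dot-U-U c = trans (ℚ∑.sum-cong-≗ λ l → term (𝟙 c l)) (∑-𝟙* c (λ _ → + 1 / 9))
    where
    term : ∀ δ → (⅓ ℚ.* ⟦ δ ⟧) ℚ.* (⅓ ℚ.* ⟦ δ ⟧) ≡ ⟦ δ ⟧ ℚ.* (+ 1 / 9)
    term true  = refl
    term false = refl

  dot-u′-u′ : ∀ c → dot (u′ c) (u′ c) ≡ ⅔
  dot-u′-u′ c = trans (dot-augment ⅔ ⅔ (U c) (U c))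
    (cong (λ z → ⅔ ℚ.* ⅔ ℚ.+ (z ℚ.+ z)) (dot-U-U c))

  -- At an endpoint the v₀-parts contribute 1/3 and each copy 1/12, in total 1/2. This equation
  -- forces the factor 3/4 in z.
  dot-v′-u′ : ∀ e c → dot (v′ e c) (u′ c) ≡ ⟦ incidence n e c ⟧ ℚ.* ½
  dot-v′-u′ e c = trans (dot-augment (⟦ β ⟧ ℚ.* ½) ⅔ (V e c) (U c))
    (trans (cong (λ z → (⟦ β ⟧ ℚ.* ½) ℚ.* ⅔ ℚ.+ (z ℚ.+ z))
      (trans (ℚ∑.sum-cong-≗ λ l → term β (𝟙 c l) (incidence n e l))
        -- Coefficients of β(δ/2 - p/4)·δ/3 after replacing δ² by δ.
        (∑-form n e c (⟦ β ⟧ ℚ.* (+ 1 / 6)) 0ℚ (ℚ.- (⟦ β ⟧ ℚ.* (+ 1 / 12))))))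
      (total β))
    where
    β : Bool
    β = incidence n e c
    term : ∀ β δ p → (⟦ β ⟧ ℚ.* (½ ℚ.* ⟦ δ ⟧ ℚ.- ¼ ℚ.* ⟦ p ⟧)) ℚ.* (⅓ ℚ.* ⟦ δ ⟧)
      ≡ (⟦ β ⟧ ℚ.* (+ 1 / 6) ℚ.* ⟦ δ ⟧ ℚ.+ 0ℚ ℚ.* ⟦ p ⟧)
        ℚ.+ (ℚ.- (⟦ β ⟧ ℚ.* (+ 1 / 12))) ℚ.* (⟦ δ ⟧ ℚ.* ⟦ p ⟧)
    term true  true  true  = refl
    term true  true  false = refl
    term true  false true  = refl
    term true  false false = refl
    term false true  true  = refl
    term false true  false = refl
    term false false true  = refl
    term false false false = refl
    total : ∀ β → let z = (⟦ β ⟧ ℚ.* (+ 1 / 6) ℚ.+ 0ℚ ℚ.* ι 2)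
                          ℚ.+ (ℚ.- (⟦ β ⟧ ℚ.* (+ 1 / 12))) ℚ.* ⟦ β ⟧
      in (⟦ β ⟧ ℚ.* ½) ℚ.* ⅔ ℚ.+ (z ℚ.+ z) ≡ ⟦ β ⟧ ℚ.* ½
    total true  = refl
    total false = refl

  -- At an endpoint, 1/4 from the v₀-part and 1/8 from each copy.
  dot-v′-v′ : ∀ e c → dot (v′ e c) (v′ e c) ≡ ⟦ incidence n e c ⟧ ℚ.* ½
  dot-v′-v′ e c = trans (dot-augment (⟦ β ⟧ ℚ.* ½) (⟦ β ⟧ ℚ.* ½) (V e c) (V e c))
    (trans (cong (λ z → (⟦ β ⟧ ℚ.* ½) ℚ.* (⟦ β ⟧ ℚ.* ½) ℚ.+ (z ℚ.+ z))
      (trans (ℚ∑.sum-cong-≗ λ l → term β (𝟙 c l) (incidence n e l))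
        -- Coefficients of β(δ/2 - p/4)² after replacing squares of bits by bits.
        (∑-form n e c (⟦ β ⟧ ℚ.* ¼) (⟦ β ⟧ ℚ.* (+ 1 / 16)) (ℚ.- (⟦ β ⟧ ℚ.* ¼)))))
      (total β))
    where
    β : Bool
    β = incidence n e c
    term : ∀ β δ p → let z = ⟦ β ⟧ ℚ.* (½ ℚ.* ⟦ δ ⟧ ℚ.- ¼ ℚ.* ⟦ p ⟧) in z ℚ.* z
      ≡ (⟦ β ⟧ ℚ.* ¼ ℚ.* ⟦ δ ⟧ ℚ.+ ⟦ β ⟧ ℚ.* (+ 1 / 16) ℚ.* ⟦ p ⟧)
        ℚ.+ (ℚ.- (⟦ β ⟧ ℚ.* ¼)) ℚ.* (⟦ δ ⟧ ℚ.* ⟦ p ⟧)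
    term true  true  true  = refl
    term true  true  false = refl
    term true  false true  = refl
    term true  false false = refl
    term false true  true  = refl
    term false true  false = refl
    term false false true  = refl
    term false false false = refl
    total : ∀ β → let z = (⟦ β ⟧ ℚ.* ¼ ℚ.+ ⟦ β ⟧ ℚ.* (+ 1 / 16) ℚ.* ι 2)
                          ℚ.+ (ℚ.- (⟦ β ⟧ ℚ.* ¼)) ℚ.* ⟦ β ⟧
      in (⟦ β ⟧ ℚ.* ½) ℚ.* (⟦ β ⟧ ℚ.* ½) ℚ.+ (z ℚ.+ z) ≡ ⟦ β ⟧ ℚ.* ½
    total true  = refl
    total false = refl

  ∑-half-incidence : ∀ e → ∑ (λ c → ⟦ incidence n e c ⟧ ℚ.* ½) ≡ 1ℚ
  ∑-half-incidence e = trans (sym (ℚ∑.*-distribʳ-sum ½ (⟦_⟧ ∘ incidence n e)))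
    (cong (ℚ._* ½) (∑-incidence n e))

  -- The contributions z and -z of the two endpoints cancel.
  ∑-V : ∀ e l → ∑ (λ c → V e c l) ≡ 0ℚ
  ∑-V e l = trans
    (ℚ∑.sum-cong-≗ λ c → trans
      -- Symmetry of `𝟙` makes `c` the running index, as `∑-form` requires.
      (cong (λ z → ⟦ incidence n e c ⟧ ℚ.* (½ ℚ.* ⟦ z ⟧ ℚ.- ¼ ℚ.* p)) (𝟙-sym c l))
      (solve 3 (λ β δ p → β :* (con ½ :* δ :- con ¼ :* p)
        := (con 0ℚ :* δ :+ (:- (con ¼ :* p)) :* β) :+ con ½ :* (δ :* β)) refl
        ⟦ incidence n e c ⟧ ⟦ 𝟙 l c ⟧ p))
    (trans (∑-form n e l 0ℚ (ℚ.- (¼ ℚ.* p)) ½)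
      (solve 1 (λ p → (con 0ℚ :+ (:- (con ¼ :* p)) :* con (ι 2)) :+ con ½ :* p := con 0ℚ) refl p))
    where
    open +-*-Solver hiding (⟦_⟧)
    p : ℚ
    p = ⟦ incidence n e l ⟧

  real : ∀ {D} → Vector ℚ D → ℝ^ D
  real x i = fromℚ (x i)

  real-≐ : ∀ {D} (x : Vector ℚ D) i → real x i ≐ x i
  real-≐ x i = fromℚ-seq (x i)

  ⟨real⟩ : ∀ {D} (x y : Vector ℚ D) → ⟨ real x , real y ⟩ ≐ dot x y
  ⟨real⟩ x y = ⟨⟩-≐ (real-≐ x) (real-≐ y)

  ⟨real⟩-≈ : ∀ {D} (x y x′ y′ : Vector ℚ D) → dot x y ≡ dot x′ y′ →
    ⟨ real x , real y ⟩ ≈ ⟨ real x′ , real y′ ⟩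
  ⟨real⟩-≈ x y x′ y′ h = ≐⇒≈ (⟨real⟩ x y) λ t → trans (⟨real⟩ x′ y′ t) (sym h)

  solution : ∀ {k} → n ℕ.* 2 ≡ k ℕ.* 3 → SDPSolution (#edges n) n k
  solution {k} 2n≡3k = record
    { D           = suc (n ℕ.+ n)
    ; v₀          = real v₀′
    ; v           = λ e c → real (v′ e c)
    ; u           = λ c → real (u′ c)
    ; v₀-unit     = ≐⇒≈ (⟨real⟩ v₀′ v₀′) λ t → trans (fromℚ-seq 1ℚ t) (sym (dot-v₀′ 1ℚ (λ _ → 0ℚ)))
    ; v-v₀        = λ e c → ⟨real⟩-≈ (v′ e c) v₀′ (v′ e c) (v′ e c)
                      (trans (dot-v₀′ _ (V e c)) (sym (dot-v′-v′ e c)))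
    ; u-v₀        = λ c → ⟨real⟩-≈ (u′ c) v₀′ (u′ c) (u′ c)
                      (trans (dot-v₀′ _ (U c)) (sym (dot-u′-u′ c)))
    ; v-u         = λ e c → ⟨real⟩-≈ (v′ e c) (u′ c) (v′ e c) (v′ e c)
                      (trans (dot-v′-u′ e c) (sym (dot-v′-v′ e c)))
    ; assignment  = λ e → ≐⇒≈
        (λ t → trans (⟨⟩-≐ {x = residual e} {residual e} (residual≐0 e) (residual≐0 e) t)
          (dot-zeroʳ {suc (n ℕ.+ n)} (λ _ → 0ℚ)))
        (fromℚ-seq 0ℚ)
    ; cardinality = ≈⇒≤ (≐⇒≈ (sum-≐ λ c → ⟨real⟩ (u′ c) (u′ c))
        λ t → trans (fromℚ-seq (ι k) t) (sym cardinality′))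
    }
    where
    residual : Fin (#edges n) → ℝ^ suc (n ℕ.+ n)
    residual e = vsum (λ c → real (v′ e c)) ⊖ real v₀′
    residual≐0 : ∀ e i → residual e i ≐ 0ℚ
    residual≐0 e i t = trans (minus-seq (vsum (λ c → real (v′ e c)) i) (real v₀′ i) t) (trans
      (cong₂ ℚ._-_
        (trans (sum-≐ (λ c → real-≐ (v′ e c) i) t)
          (trans (∑-augment (λ c → ⟦ incidence n e c ⟧ ℚ.* ½) (V e) i)
            (augment-cong (∑-half-incidence e) (∑-V e) i)))
        (real-≐ v₀′ i t))
      (ℚₚ.+-inverseʳ (v₀′ i)))

    cardinality′ : ∑ (λ c → dot (u′ c) (u′ c)) ≡ ι k
    cardinality′ = begin
      ∑ (λ c → dot (u′ c) (u′ c))  ≡⟨ ℚ∑.sum-cong-≗ dot-u′-u′ ⟩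
      ∑ {n} (λ _ → ⅔)              ≡⟨ ∑-const n ⅔ ⟩
      -- Writing 2/3 as 2·(1/3) brings in 2n = 3k.
      ι n ℚ.* (ι 2 ℚ.* ⅓)          ≡⟨ ℚₚ.*-assoc (ι n) (ι 2) ⅓ ⟨
      ι n ℚ.* ι 2 ℚ.* ⅓            ≡⟨ cong (ℚ._* ⅓) (trans (sym (ι-* n 2))
                                        (trans (cong ι 2n≡3k) (ι-* k 3))) ⟩
      ι k ℚ.* ι 3 ℚ.* ⅓            ≡⟨ ℚₚ.*-assoc (ι k) (ι 3) ⅓ ⟩
      ι k ℚ.* 1ℚ                   ≡⟨ ℚₚ.*-identityʳ (ι k) ⟩
      ι k                          ∎
      where open ≡-Reasoning

  distance : Fin (#edges n) → Fin n → ℕ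
  distance e c = if incidence n e c then 1 else 3

  1≤distance : ∀ e c → 1 ≤ⁿ distance e c
  1≤distance e c with incidence n e c
  ... | true  = ℕ.s≤s ℕ.z≤n
  ... | false = ℕ.s≤s ℕ.z≤n

  -- The mass of `solution` lies entirely at distance 1, so every edge costs exactly 1, which meets
  -- the lower bound.
  optimum : ∀ {k} → n ℕ.* 2 ≡ k ℕ.* 3 → (d : Fin (#edges n) → Fin n → ℝ) →
    (∀ e c → d e c ≐ ι (distance e c)) → IsSDPOptimum d k (fromℕ (#edges n))
  optimum {k} 2n≡3k d d≐ = record
    { attained   = solution {k} 2n≡3k , ≐⇒≈ (sum-≐ cost) λ t →
        trans (fromℚ-seq (ι (#edges n)) t) (sym (trans (∑-const (#edges n) 1ℚ) (ℚₚ.*-identityʳ _)))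
    ; lowerBound = sdp-lowerBound d λ e c t →
        subst (1ℚ ℚ.≤_) (sym (d≐ e c t)) (ι-mono (1≤distance e c))
    }
    where
    open SDPSolution (solution {k} 2n≡3k)
    masses : ∀ e c t → seq (‖ v e c ‖₂² * d e c) t ≡ ⟦ incidence n e c ⟧ ℚ.* ½
    masses e c t = trans (*-seq ‖ v e c ‖₂² (d e c) t) (trans
      (cong₂ ℚ._*_ (trans (⟨real⟩ (v′ e c) (v′ e c) t) (dot-v′-v′ e c)) (d≐ e c t))
      supported)
      where
      supported : ⟦ incidence n e c ⟧ ℚ.* ½ ℚ.* ι (distance e c) ≡ ⟦ incidence n e c ⟧ ℚ.* ½
      supported with incidence n e c
      ... | true  = refl
      ... | false = refl
    cost : ∀ e → sum (λ c → ‖ v e c ‖₂² * d e c) ≐ 1ℚ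
    cost e t = trans (sum-≐ (masses e) t) (∑-half-incidence e)

-- Integral solutions

opaque
  unfolding _+_
  -- Different bits are 1 apart, hence not within 1/2 at any index.
  ⟦⟧-separated : ∀ a b → fromℚ ⟦ a ⟧ ≈ fromℚ ⟦ b ⟧ → a ≡ b
  ⟦⟧-separated true  true  h = refl
  ⟦⟧-separated false false h = refl
  ⟦⟧-separated true  false h with h ½ (ℚₚ.positive⁻¹ ½)
  ... | N , p with ℚ.*≤* (ℤ.+≤+ (ℕ.s≤s ())) ← p N ℕₚ.≤-refl
  ⟦⟧-separated false true  h with h ½ (ℚₚ.positive⁻¹ ½)
  ... | N , p with ℚ.*≤* (ℤ.+≤+ (ℕ.s≤s ())) ← p N ℕₚ.≤-refl

-- The instances: embedding, separation and SDP value

cube : ∀ {N} → Vector Bool N → ℝ^ N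
cube a i = fromℚ ⟦ a i ⟧

cube-≐ : ∀ {N} (a : Vector Bool N) i → cube a i ≐ ⟦ a i ⟧
cube-≐ a i = fromℚ-seq ⟦ a i ⟧

cube-injective : ∀ {N} {a b : Vector Bool N} → cube a ≋ cube b → a ≗ b
cube-injective {a = a} {b} h i = ⟦⟧-separated (a i) (b i) (h i)

graphInstance : ℕ → ℕ → Instance
graphInstance n k = record
  { dim             = n
  ; #centers        = n
  ; #points         = #edges n
  ; k               = k
  ; center          = cube ∘ 𝟙
  ; point           = cube ∘ incidence n
  ; center-distinct = λ {i} {j} h → 𝟙-injective (cube-injective {a = 𝟙 i} {𝟙 j} h)
  ; point-distinct  = λ {e} {e′} h →
      incidence-injective n (cube-injective {a = incidence n e} {incidence n e′} h)
  }

unscaled : ∀ {N} (a : Vector Bool N) i → (1ℝ · cube a) i ≐ ⟦ a i ⟧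
unscaled a i t = trans (*-seq 1ℝ (fromℚ ⟦ a i ⟧) t) (trans
  (cong₂ ℚ._*_ (fromℚ-seq 1ℚ t) (fromℚ-seq ⟦ a i ⟧ t)) (ℚₚ.*-identityˡ ⟦ a i ⟧))

-- Distinct bit vectors have a nonzero Hamming distance, which is a natural number and so at least
-- 1.
cube-separated : ∀ prob {N} (a b : Vector Bool N) → ¬ (cube a ≋ cube b) →
  1ℝ ≤ connection prob (1ℝ · cube a) (1ℝ · cube b)
cube-separated prob a b a≢b = seq-≤⇒≤ (0 , λ t _ → subst₂ ℚ._≤_
  (sym (fromℚ-seq 1ℚ t))
  (sym (connection-≐ prob (1ℝ · cube a) (1ℝ · cube b) a b (unscaled a) (unscaled b) t))
  (ι-mono (ℕₚ.n≢0⇒n>0 λ h → a≢b λ i →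
    seq-≡⇒≈ λ t → cong (λ z → seq (fromℚ ⟦ z ⟧) t) (sym (hamming≡0⇒≗ b a h i)))))

module _ (n k : ℕ) (2n≡3k : n ℕ.* 2 ≡ k ℕ.* 3) (prob : Problem) where
  open CompleteGraphSDP n

  -- Stated for any vectors with these coordinates, so that it covers both the instance and its
  -- rescaled copy.
  graph-optimum : (x : Fin (#edges n) → ℝ^ n) (y : Fin n → ℝ^ n) →
    (∀ e i → x e i ≐ ⟦ incidence n e i ⟧) → (∀ c i → y c i ≐ ⟦ 𝟙 c i ⟧) →
    IsSDPOptimum (λ e c → connection prob (x e) (y c)) k (fromℕ (#edges n))
  graph-optimum x y hx hy = optimum 2n≡3k (λ e c → connection prob (x e) (y c)) λ e c t →
    trans (connection-≐ prob (x e) (y c) (incidence n e) (𝟙 c) (hx e) (hy c) t)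
      (cong ι (hamming-𝟙-incidence n e c))

  graph-wellSeparated : 2 ≤ⁿ n → WellSeparated prob (graphInstance n k)
  -- The optimum is one per edge, so the average cost is already 1 and the scale is 1.
  graph-wellSeparated 2≤n = #edges-nonZero 2≤n , 1ℝ , fromℚ-pos (ℚₚ.positive⁻¹ 1ℚ)
    , graph-optimum (λ e → 1ℝ · cube (incidence n e)) (λ c → 1ℝ · cube (𝟙 c))
        (λ e → unscaled (incidence n e)) (λ c → unscaled (𝟙 c))
    , λ { (inj₁ e) (inj₁ e′) → cube-separated prob (incidence n e) (incidence n e′)
        ; (inj₁ e) (inj₂ c)  → cube-separated prob (incidence n e) (𝟙 c)
        ; (inj₂ c) (inj₁ e)  → cube-separated prob (𝟙 c) (incidence n e)
        ; (inj₂ c) (inj₂ c′) → cube-separated prob (𝟙 c) (𝟙 c′) }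

  graph-value : IsSDPValue prob (graphInstance n k) (fromℕ (#edges n))
  graph-value = graph-optimum (cube ∘ incidence n) (cube ∘ 𝟙)
    (cube-≐ ∘ incidence n) (cube-≐ ∘ 𝟙)

-- Integral costs and the count of missed edges

minOver-≥ : ∀ {m} (C : Subset m) ne (f : Fin m → ℝ) q t →
  (∀ c → c ∈ C → q ℚ.≤ seq (f c) t) → q ℚ.≤ seq (minOver C ne f) t
minOver-≥ C (c₀ , c₀∈C) f q t h =
  go (filter (_∈? C) (allFin _)) (all-filter (_∈? C) (allFin _))
  where
  go : ∀ cs → All (_∈ C) cs → q ℚ.≤ seq (List.foldr (λ c r → f c ⊓ r) (f c₀) cs) t
  -- The seed is itself the cost of an open center.
  go List.[]       []           = h c₀ c₀∈C
  go (c List.∷ cs) (c∈C ∷ cs⊆C) = subst (q ℚ.≤_) (sym (⊓-seq (f c) _ t))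
    (ℚₚ.⊓-glb (h c c∈C) (go cs cs⊆C))

∑ⁿ-affine : ∀ {n} (f : Vector ℕ n) → ∑ⁿ (λ i → 1 ℕ.+ 2 ℕ.* f i) ≡ n ℕ.+ 2 ℕ.* ∑ⁿ f
∑ⁿ-affine {zero}  f = refl
∑ⁿ-affine {suc n} f = trans (cong (1 ℕ.+ 2 ℕ.* f zero ℕ.+_) (∑ⁿ-affine (f ∘ suc)))
  (solve 3 (λ a n s → (con 1 :+ con 2 :* a) :+ (n :+ con 2 :* s)
    := (con 1 :+ n) :+ con 2 :* (a :+ s)) refl (f zero) n (∑ⁿ (f ∘ suc)))
  where open ℕ-Solver.+-*-Solver

module _ {n : ℕ} (C : Subset n) where

  unopened : Vector Bool n
  unopened = not ∘ lookup C

  -- In this affine form the sum separates into all edges and the edges between unopened vertices.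
  costBound : Fin (#edges n) → ℕ
  costBound e = 1 ℕ.+ 2 ℕ.* bit (induced n unopened e)

  -- Distance 1 means that the open center `c` is an endpoint, so the edge is not induced by
  -- unopened vertices; at distance 3 the bound is trivial.
  costBound-≤-distance : ∀ e c → c ∈ C → costBound e ≤ⁿ CompleteGraphSDP.distance n e c
  costBound-≤-distance e c c∈C with incidence n e c in p
  ... | true rewrite induced-incident n unopened e c p (cong not ([]=⇒lookup c∈C)) = ℕₚ.≤-refl
  ... | false with induced n unopened e
  ...   | true  = ℕₚ.≤-refl
  ...   | false = ℕ.s≤s ℕ.z≤n

  integralCost-≥ : ∀ prob k ne t →
    ι (#edges n ℕ.+ 2 ℕ.* weight (induced n unopened))
      ℚ.≤ seq (integralCost prob (graphInstance n k) C ne) t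
  integralCost-≥ prob k ne t = subst₂ ℚ._≤_
    (trans (∑-ι costBound) (cong ι (∑ⁿ-affine (bit ∘ induced n unopened))))
    (sym (sum-seq (λ e → minOver C ne (d e)) t))
    (∑-mono λ e → minOver-≥ C ne (d e) (ι (costBound e)) t λ c c∈C →
      subst (ι (costBound e) ℚ.≤_) (sym (d-seq e c)) (ι-mono (costBound-≤-distance e c c∈C)))
    where
    d : Fin (#edges n) → Fin n → ℝ
    d e c = connection prob (cube (incidence n e)) (cube (𝟙 c))
    d-seq : ∀ e c → seq (d e c) t ≡ ι (CompleteGraphSDP.distance n e c)
    d-seq e c = trans
      (connection-≐ prob _ _ (incidence n e) (𝟙 c) (cube-≐ (incidence n e)) (cube-≐ (𝟙 c)) t)
      (cong ι (hamming-𝟙-incidence n e c))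

-- Here P = n(n - 1) with n = 60s and Q = m(m - 1), twice the respective edge counts. At m = 19s the
-- difference 125Q - 12P is 1925s² - 1655s, nonnegative for s ≥ 1, and Q grows with m.
induced-edges-≥ : ∀ s P Q m → 1 ≤ⁿ s →
  P ℕ.+ 60 ℕ.* s ≡ (60 ℕ.* s) ℕ.* (60 ℕ.* s) → Q ℕ.+ m ≡ m ℕ.* m → 19 ℕ.* s ≤ⁿ m →
  12 ℕ.* P ≤ⁿ 125 ℕ.* Q
induced-edges-≥ s P Q m 1≤s hP hQ 19s≤m =
  -- The added terms avoid subtraction: 720 = 12·60 and 1925 = 125·19² - 12·60².
  ℕₚ.+-cancelʳ-≤ (720 ℕ.* s ℕ.+ 1925 ℕ.* (s ℕ.* s)) (12 ℕ.* P) (125 ℕ.* Q) (begin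
    12 ℕ.* P ℕ.+ (720 ℕ.* s ℕ.+ 1925 ℕ.* (s ℕ.* s))
      ≡⟨ solve 2 (λ P s → con 12 :* P :+ (con 720 :* s :+ con 1925 :* (s :* s))
           := con 12 :* (P :+ con 60 :* s) :+ con 1925 :* (s :* s)) refl P s ⟩
    12 ℕ.* (P ℕ.+ 60 ℕ.* s) ℕ.+ 1925 ℕ.* (s ℕ.* s)
      ≡⟨ cong (λ z → 12 ℕ.* z ℕ.+ 1925 ℕ.* (s ℕ.* s)) hP ⟩
    12 ℕ.* ((60 ℕ.* s) ℕ.* (60 ℕ.* s)) ℕ.+ 1925 ℕ.* (s ℕ.* s)
      ≡⟨ solve 1 (λ s → con 12 :* ((con 60 :* s) :* (con 60 :* s)) :+ con 1925 :* (s :* s)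
           := con 125 :* ((con 19 :* s) :* (con 19 :* s))) refl s ⟩
    125 ℕ.* ((19 ℕ.* s) ℕ.* (19 ℕ.* s))  ≤⟨ ℕₚ.*-monoʳ-≤ 125 monotone ⟩
    125 ℕ.* (Q ℕ.+ 19 ℕ.* s)
      ≡⟨ solve 2 (λ Q s → con 125 :* (Q :+ con 19 :* s)
           := con 125 :* Q :+ (con 720 :* s :+ con 1655 :* s)) refl Q s ⟩
    125 ℕ.* Q ℕ.+ (720 ℕ.* s ℕ.+ 1655 ℕ.* s)
      ≤⟨ ℕₚ.+-monoʳ-≤ (125 ℕ.* Q) (ℕₚ.+-monoʳ-≤ (720 ℕ.* s)
           (ℕₚ.*-mono-≤ {1655} {1925} (ℕₚ.m≤m+n 1655 270)
             (ℕₚ.m≤m*n s s {{ℕ.>-nonZero 1≤s}}))) ⟩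
    125 ℕ.* Q ℕ.+ (720 ℕ.* s ℕ.+ 1925 ℕ.* (s ℕ.* s)) ∎)
  where
  open ℕₚ.≤-Reasoning
  open ℕ-Solver.+-*-Solver
  M j : ℕ
  M = 19 ℕ.* s
  j = m ℕ.∸ M
  m≡M+j : m ≡ M ℕ.+ j
  m≡M+j = sym (ℕₚ.m+[n∸m]≡n 19s≤m)
  j≤j² : ∀ j → j ≤ⁿ j ℕ.* j
  j≤j² zero    = ℕ.z≤n
  j≤j² (suc j) = ℕₚ.m≤m*n (suc j) (suc j)
  -- This is M² - M ≤ m² - m without subtraction; for m = M + j it follows from j ≤ j².
  monotone : M ℕ.* M ≤ⁿ Q ℕ.+ M
  monotone = ℕₚ.+-cancelʳ-≤ j (M ℕ.* M) (Q ℕ.+ M) (begin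
    M ℕ.* M ℕ.+ j
      ≤⟨ ℕₚ.+-monoʳ-≤ (M ℕ.* M) (ℕₚ.≤-trans (j≤j² j) (ℕₚ.m≤n+m (j ℕ.* j) (2 ℕ.* (M ℕ.* j)))) ⟩
    M ℕ.* M ℕ.+ (2 ℕ.* (M ℕ.* j) ℕ.+ j ℕ.* j)
      ≡⟨ solve 2 (λ M j → M :* M :+ (con 2 :* (M :* j) :+ j :* j)
           := (M :+ j) :* (M :+ j)) refl M j ⟩
    (M ℕ.+ j) ℕ.* (M ℕ.+ j)  ≡⟨ cong (λ z → z ℕ.* z) m≡M+j ⟨
    m ℕ.* m                  ≡⟨ hQ ⟨
    Q ℕ.+ m                  ≡⟨ cong (Q ℕ.+_) m≡M+j ⟩
    Q ℕ.+ (M ℕ.+ j)          ≡⟨ ℕₚ.+-assoc Q M j ⟨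
    Q ℕ.+ M ℕ.+ j            ∎)

-- Since 149 = 125 + 12·2, removing 125E from both sides leaves 12·(2E) ≤ 125·(2u), with E all edges
-- and u those between unopened vertices.
cost-ratio : ∀ s → 1 ≤ⁿ s → (C : Subset (60 ℕ.* s)) → ∣ C ∣ ≤ⁿ 41 ℕ.* s →
  149 ℕ.* #edges (60 ℕ.* s)
    ≤ⁿ 125 ℕ.* (#edges (60 ℕ.* s) ℕ.+ 2 ℕ.* weight (induced (60 ℕ.* s) (unopened C)))
cost-ratio s 1≤s C |C|≤41s = begin
  149 ℕ.* E                          ≡⟨ solve 1 (λ e → con 149 :* e
                                          := con 125 :* e :+ con 12 :* (con 2 :* e)) refl E ⟩
  125 ℕ.* E ℕ.+ 12 ℕ.* (2 ℕ.* E)     ≤⟨ ℕₚ.+-monoʳ-≤ (125 ℕ.* E)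
                                          (induced-edges-≥ s (2 ℕ.* E) (2 ℕ.* u) m 1≤s
                                            (#edges-double (60 ℕ.* s))
                                            (induced-count (60 ℕ.* s) (unopened C)) 19s≤m) ⟩
  125 ℕ.* E ℕ.+ 125 ℕ.* (2 ℕ.* u)    ≡⟨ ℕₚ.*-distribˡ-+ 125 E (2 ℕ.* u) ⟨
  125 ℕ.* (E ℕ.+ 2 ℕ.* u)            ∎
  where
  open ℕₚ.≤-Reasoning
  open ℕ-Solver.+-*-Solver
  E u m : ℕ
  E = #edges (60 ℕ.* s)
  u = weight (induced (60 ℕ.* s) (unopened C))
  m = weight (unopened C)
  19s≤m : 19 ℕ.* s ≤ⁿ m
  19s≤m = ℕₚ.+-cancelˡ-≤ (41 ℕ.* s) (19 ℕ.* s) m (begin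
    41 ℕ.* s ℕ.+ 19 ℕ.* s  ≡⟨ ℕₚ.*-distribʳ-+ s 41 19 ⟨
    60 ℕ.* s               ≡⟨ weight-complement C ⟨
    ∣ C ∣ ℕ.+ m            ≤⟨ ℕₚ.+-monoˡ-≤ m |C|≤41s ⟩
    41 ℕ.* s ℕ.+ m         ∎)

-- The budget of centers, the ratio and the family

1/40 : ℚ
1/40 = + 1 / 40

budget : ∀ s c → fromℕ c ≤ fromℕ (40 ℕ.* s) + fromℚ 1/40 * fromℕ (40 ℕ.* s) → c ≤ⁿ 41 ℕ.* s
-- Both sequences are constant, so a single index with error 1/2 decides the inequality.
budget s c h with ≤-elim h ½ (ℚₚ.positive⁻¹ ½)
... | N , p = ι-cancel-½ (subst₂ (λ x y → x ℚ.≤ y ℚ.+ ½) (fromℚ-seq (ι c) N) total (p N ℕₚ.≤-refl))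
  where
  open ≡-Reasoning
  total : seq (fromℕ (40 ℕ.* s) + fromℚ 1/40 * fromℕ (40 ℕ.* s)) N ≡ ι (41 ℕ.* s)
  total = begin
    seq (fromℕ (40 ℕ.* s) + fromℚ 1/40 * fromℕ (40 ℕ.* s)) N
      ≡⟨ trans (+-seq _ _ N) (cong₂ ℚ._+_ (fromℚ-seq (ι (40 ℕ.* s)) N) (trans (*-seq _ _ N)
           (cong₂ ℚ._*_ (fromℚ-seq 1/40 N) (fromℚ-seq (ι (40 ℕ.* s)) N)))) ⟩
    ι (40 ℕ.* s) ℚ.+ 1/40 ℚ.* ι (40 ℕ.* s)
      ≡⟨ cong (λ z → z ℚ.+ 1/40 ℚ.* z) (ι-* 40 s) ⟩
    ι 40 ℚ.* ι s ℚ.+ 1/40 ℚ.* (ι 40 ℚ.* ι s)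
      ≡⟨ solve 1 (λ s → con (ι 40) :* s :+ con 1/40 :* (con (ι 40) :* s)
           := con (ι 41) :* s) refl (ι s) ⟩
    ι 41 ℚ.* ι s   ≡⟨ ι-* 41 s ⟨
    ι (41 ℕ.* s)   ∎
    where open +-*-Solver using (solve; _:=_; _:*_; _:+_; con)

ratio-bound : ∀ ε opt cost E B → 0ℝ < ε → opt ≐ ι E → 149 ℕ.* E ≤ⁿ 125 ℕ.* B →
  (∀ t → ι B ℚ.≤ seq cost t) → (fromℚ (+ 149 / 125) - ε) * opt ≤ cost
ratio-bound ε opt cost E B 0<ε opt≐ 149E≤125B B≤cost = seq-≤⇒≤ (Eventually-map
  (λ t 0≤ε → begin
    seq ((fromℚ (+ 149 / 125) - ε) * opt) t
      ≡⟨ trans (*-seq _ opt t) (cong₂ ℚ._*_ (trans (minus-seq _ ε t)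
           (cong (ℚ._- seq ε t) (fromℚ-seq (+ 149 / 125) t))) (opt≐ t)) ⟩
    (+ 149 / 125 ℚ.- seq ε t) ℚ.* ι E
      -- From some index on the approximations of ε are nonnegative, so dropping ε can only enlarge
      -- the factor.
      ≤⟨ ℚₚ.*-monoʳ-≤-nonNeg (ι E) {{ℚ.nonNegative (0≤ι E)}}
           (ℚₚ.≤-trans (ℚₚ.+-monoʳ-≤ (+ 149 / 125) (ℚₚ.neg-antimono-≤ 0≤ε))
             (ℚₚ.≤-reflexive (ℚₚ.+-identityʳ (+ 149 / 125)))) ⟩
    (+ 1 / 125) ℚ.* ι 149 ℚ.* ι E
      ≡⟨ trans (ℚₚ.*-assoc (+ 1 / 125) (ι 149) (ι E)) (cong ((+ 1 / 125) ℚ.*_) (sym (ι-* 149 E))) ⟩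
    (+ 1 / 125) ℚ.* ι (149 ℕ.* E)
      ≤⟨ ℚₚ.*-monoˡ-≤-nonNeg (+ 1 / 125) (ι-mono 149E≤125B) ⟩
    (+ 1 / 125) ℚ.* ι (125 ℕ.* B)
      ≡⟨ trans (cong ((+ 1 / 125) ℚ.*_) (ι-* 125 B)) (sym (ℚₚ.*-assoc (+ 1 / 125) (ι 125) (ι B))) ⟩
    1ℚ ℚ.* ι B  ≡⟨ ℚₚ.*-identityˡ (ι B) ⟩
    ι B         ≤⟨ B≤cost t ⟩
    seq cost t  ∎)
  (0<⇒seq-nonneg 0<ε))
  where open ℚₚ.≤-Reasoning

-- With n a multiple of 60, k = 2n/3 is a multiple of 40 and the budget (1 + 1/40)k is an integer.
-- `suc` excludes the empty graph.
gapInstance : ℕ → Instance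
gapInstance s = graphInstance (60 ℕ.* suc s) (40 ℕ.* suc s)

theorem3p26 : ∀ (prob : Problem) (ε : ℝ) → 0ℝ < ε →
    ∃ λ (δ : ℝ) → 0ℝ < δ ×
    Σ (Instance → Set) λ Family →
    (∀ (K : ℕ) → ∃ λ (I : Instance) → Family I × K ≤ⁿ Instance.k I) ×
    (∀ (I : Instance) → Family I →
    WellSeparated prob I ×
    IntegralityGap prob I (fromℚ (+ 149 / 125) - ε) δ)
theorem3p26 prob ε 0<ε = fromℚ 1/40 , fromℚ-pos (ℚₚ.positive⁻¹ 1/40)
  , (λ I → ∃ λ s → I ≡ gapInstance s)
  , (λ K → gapInstance K , (K , refl) , ℕₚ.≤-trans (ℕₚ.n≤1+n K) (ℕₚ.m≤n*m (suc K) 40))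
  , λ { I (s , refl) →
        graph-wellSeparated (n s) (k s) (2n≡3k (suc s)) prob
          (ℕₚ.≤-trans (ℕₚ.m≤m+n 2 58) (ℕₚ.m≤m*n 60 (suc s)))
      , fromℕ (#edges (n s))
      , graph-value (n s) (k s) (2n≡3k (suc s)) prob
      , λ C ne |C|≤ → ratio-bound ε (fromℕ (#edges (n s)))
          (integralCost prob (gapInstance s) C ne)
          (#edges (n s)) (#edges (n s) ℕ.+ 2 ℕ.* weight (induced (n s) (unopened C)))
          0<ε (fromℚ-seq (ι (#edges (n s))))
          (cost-ratio (suc s) (ℕ.s≤s ℕ.z≤n) C (budget (suc s) ∣ C ∣ |C|≤))
          (integralCost-≥ C prob (k s) ne) }
  where
  n k : ℕ → ℕ
  n s = 60 ℕ.* suc s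
  k s = 40 ℕ.* suc s
  2n≡3k : ∀ s → (60 ℕ.* s) ℕ.* 2 ≡ (40 ℕ.* s) ℕ.* 3
  2n≡3k = solve 1 (λ s → (con 60 :* s) :* con 2 := (con 40 :* s) :* con 3) refl
    where open ℕ-Solver.+-*-Solver
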